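{- For every finite graph $G$ in which every component has at least two vertices, $\gamma_{b}(G)\leq\frac{5}{4}\operatorname{ir}_{b}(G)$.
   Context: Let $G=(V,E)$ be a finite connected graph with at least two vertices, and let $e(v)$ denote the eccentricity of $v$. A broadcast on $G$ is a function $f:V\to\{0,1,\dots,\operatorname{diam}(G)\}$ with $f(v)\le e(v)$ for all $v$. If $G$ is disconnected, a broadcast on $G$ is a union of broadcasts on its components. The cost of $f$ is $\sigma(f)=\sum_{v\in V}f(v)$. Let $V_f^+=\{v:f(v)>0\}$. A vertex $u$ hears $f$ from $v\in V_f^+$ (and $v$ $f$-dominates $u$) if $d(u,v)\le f(v)$. The broadcast $f$ is dominating if every vertex hears $f$ from some vertex of $V_f^+$. The broadcast number is $\gamma_b(G)=\min\{\sigma(f): f \text{ a dominating broadcast of } G\}$. For $v\in V_f^+$, let $N_f[v]=\{u:d(u,v)\le f(v)\}$. The $f$-private boundary $\operatorname{PB}_f(v)$ is the set of vertices $u\in N_f[v]$ that are not dominated by the broadcast obtained from $f$ by replacing the value $f(v)$ with $f(v)-1$, all other values unchanged. The broadcast $f$ is irredundant if $\operatorname{PB}_f(v)\neq\varnothing$ for every $v\in V_f^+$. For broadcasts $f$ and $g$, write $g>f$ if $g(v)\ge f(v)$ for all $v$, with strict inequality for at least one $v$. An irredundant broadcast $f$ is maximal irredundant if no broadcast $g>f$ is irredundant. Define $\operatorname{ir}_b(G)=\min\{\sigma(f): f \text{ a maximal irredundant broadcast of } G\}$. -}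

module Defs where

open import Data.Nat using (ℕ; zero; suc; _+_; _*_; _∸_; _≤_; _<_)
open import Data.Fin using (Fin; _≟_)
open import Data.Bool using (Bool; true; false)
open import Data.List using (List; map; allFin)
open import Data.Nat.ListAction using (sum)
open import Data.Product using (Σ; ∃; ∃-syntax; _×_; _,_)
open import Relation.Nullary using (¬_; yes; no)
open import Relation.Binary.PropositionalEquality using (_≡_)

record Graph (n : ℕ) : Set where
  field
    adj    : Fin n → Fin n → Bool
    sym    : ∀ u v → adj u v ≡ adj v u
    irrefl : ∀ v → adj v v ≡ false
open Graph public

module _ {n : ℕ} (G : Graph n) where

  data Walk : Fin n → Fin n → ℕ → Set where
    nil  : ∀ {v} → Walk v v 0
    cons : ∀ {u w v k} → adj G u w ≡ true → Walk w v k → Walk u v (suc k)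

  -- d(u,v) ≤ k  (false when u,v lie in different components: d = ∞)
  Dist≤ : Fin n → Fin n → ℕ → Set
  Dist≤ u v k = ∃[ m ] (m ≤ k × Walk u v m)

  IsDist : Fin n → Fin n → ℕ → Set
  IsDist u v d = Dist≤ u v d × (∀ m → Dist≤ u v m → d ≤ m)

  -- e(v) = e : eccentricity of v within its component
  IsEcc : Fin n → ℕ → Set
  IsEcc v e = (∀ u d → IsDist v u d → d ≤ e) × (∃[ u ] IsDist v u e)

  IsBroadcast : (Fin n → ℕ) → Set
  IsBroadcast f = ∀ v e → IsEcc v e → f v ≤ e

  σ : (Fin n → ℕ) → ℕ
  σ f = sum (map f (allFin n))

  Dominated : (Fin n → ℕ) → Fin n → Set
  Dominated f u = ∃[ v ] (0 < f v × Dist≤ u v (f v))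

  IsDominating : (Fin n → ℕ) → Set
  IsDominating f = ∀ u → Dominated f u

  decAt : (Fin n → ℕ) → Fin n → (Fin n → ℕ)
  decAt f v w with w ≟ v
  ... | yes _ = f v ∸ 1
  ... | no  _ = f w

  InPB : (Fin n → ℕ) → Fin n → Fin n → Set
  InPB f v u = Dist≤ u v (f v) × ¬ Dominated (decAt f v) u

  IsIrredundant : (Fin n → ℕ) → Set
  IsIrredundant f = ∀ v → 0 < f v → ∃[ u ] InPB f v u

  _≻_ : (Fin n → ℕ) → (Fin n → ℕ) → Set
  g ≻ f = (∀ v → f v ≤ g v) × (∃[ v ] f v < g v)

  IsMaximalIrredundant : (Fin n → ℕ) → Set
  IsMaximalIrredundant f =
    IsBroadcast f × IsIrredundant f ×
    (∀ g → IsBroadcast g → g ≻ f → ¬ IsIrredundant g)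

  IsBroadcastNumber : ℕ → Set
  IsBroadcastNumber k =
    (∃[ f ] (IsBroadcast f × IsDominating f × σ f ≡ k)) ×
    (∀ f → IsBroadcast f → IsDominating f → k ≤ σ f)

  IsIrNumber : ℕ → Set
  IsIrNumber k =
    (∃[ f ] (IsMaximalIrredundant f × σ f ≡ k)) ×
    (∀ f → IsMaximalIrredundant f → k ≤ σ f)

  -- every component has at least two vertices (no isolated vertices)
  NoIsolated : Set
  NoIsolated = ∀ v → ∃[ u ] adj G v u ≡ true

{-# OPTIONS --safe #-}
module Submission where

-- Let f be maximal irredundant. Raising f to 1 at an undominated vertex u must destroy
-- irredundance, so PB(v) ⊆ N[u] for some v; hence raising f by 1 on a suitable set S (taken
-- minimal) dominates the graph. Merging overlapping balls of f gives pairwise disjoint clusters,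
-- each inside a ball whose radius is its mass ρ; raising that radius by 1 makes the ball dominate
-- all the boosted balls of the cluster, within the budget 5/4 as soon as ρ ≥ 4.
-- For every nonempty T ⊆ S, raising f on T again destroys irredundance, so T reaches the whole
-- private boundary of some x ∉ T. Applied to the light clusters (ρ ≤ 3) not yet treated, this
-- yields an x that either lies unboosted in a light cluster, where it pays for the boost, or lies
-- in another cluster. In the latter case the light cluster, suitably recentred, touches the
-- cluster of x, and a star of clusters merged in this way needs only one extra unit in total.

open import Defs
open import Data.Nat using (ℕ; zero; suc; _+_; _*_; _∸_; _≤_; _<_; z≤n; s≤s; _≤?_; _<?_)
open import Data.Nat.Properties hiding (_≟_)
open import Data.Fin using (Fin; _≟_)
  renaming (zero to fzero; suc to fsuc)
open import Data.Fin.Properties using (any?; all?; ¬∀⟶∃¬)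
open import Data.Bool using (true; if_then_else_)
import Data.Bool.Properties as Bool
open import Data.List using (List; []; _∷_; allFin; filter; map; length; cartesianProduct)
import Data.List as List
open import Data.List.Properties using (map-tabulate; filter-notAll)
open import Data.List.Membership.Propositional using (_∈_; _∉_)
open import Data.List.Membership.Propositional.Properties
  using (∈-allFin; ∈-filter⁺; ∈-filter⁻; ∈-map⁺; ∈-map⁻; ∈-cartesianProduct⁺)
open import Data.List.Relation.Unary.Any using (here; there)
import Data.List.Relation.Unary.Any as Any
import Data.Nat.ListAction as ListAction
open import Data.Product using (∃; ∃-syntax; _×_; _,_; proj₁; proj₂)
open import Data.Sum using (_⊎_; inj₁; inj₂)
open import Function using (_∘_; id)
open import Relation.Nullary using (¬_; Dec; yes; no; does)
open import Relation.Nullary.Decidable using (¬?; _×-dec_; _→-dec_; map′; decidable-stable)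
open import Relation.Nullary.Negation using (contradiction)
open import Relation.Unary using (Decidable)
open import Relation.Binary.PropositionalEquality
  using (_≡_; _≢_; refl; cong; cong₂; subst; trans; module ≡-Reasoning)
  renaming (sym to ≡-sym)
open import Algebra.Properties.CommutativeMonoid.Sum +-0-commutativeMonoid
  using (sum; sum-cong-≗; ∑-distrib-+; ∑-comm; sum-replicate-zero)
open import Data.List.Membership.DecPropositional using (_∈?_)

private
  variable
    n : ℕ

-- Sums over finite types

δ : Fin n → Fin n → ℕ → ℕ
δ a b x = if does (a ≟ b) then x else 0

δ-refl : (a : Fin n) (x : ℕ) → δ a a x ≡ x
δ-refl a x with a ≟ a
... | yes _  = refl
... | no a≢a = contradiction refl a≢a

δ-≢ : {a b : Fin n} (x : ℕ) → a ≢ b → δ a b x ≡ 0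
δ-≢ {a = a} {b} x a≢b with a ≟ b
... | yes a≡b = contradiction a≡b a≢b
... | no _    = refl

sum-mono : {g h : Fin n → ℕ} → (∀ v → g v ≤ h v) → sum g ≤ sum h
sum-mono {n = zero}  g≤h = z≤n
sum-mono {n = suc n} g≤h = +-mono-≤ (g≤h fzero) (sum-mono (λ v → g≤h (fsuc v)))

sum-*ˡ : (k : ℕ) (g : Fin n → ℕ) → k * sum g ≡ sum (λ v → k * g v)
sum-*ˡ {n = zero}  k g = *-zeroʳ k
sum-*ˡ {n = suc n} k g =
  trans (*-distribˡ-+ k (g fzero) _) (cong (k * g fzero +_) (sum-*ˡ k (λ v → g (fsuc v))))

sum-δ : (a : Fin n) (x : ℕ) → sum (λ b → δ a b x) ≡ x
sum-δ {n = suc n} fzero    x = trans (cong (x +_) (sum-replicate-zero n)) (+-identityʳ x)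
sum-δ {n = suc n} (fsuc a) x = trans (sum-cong-≗ {n = n} shift) (sum-δ a x)
  where
  shift : ∀ b → δ (fsuc a) (fsuc b) x ≡ δ a b x
  shift b with a ≟ b
  ... | yes _ = refl
  ... | no _  = refl

delete : Fin n → (Fin n → ℕ) → Fin n → ℕ
delete v h u = if does (u ≟ v) then 0 else h u

delete-≢ : {u v : Fin n} (h : Fin n → ℕ) → u ≢ v → delete v h u ≡ h u
delete-≢ {u = u} {v} h u≢v with u ≟ v
... | yes u≡v = contradiction u≡v u≢v
... | no _    = refl

sum-delete : (h : Fin n → ℕ) (v : Fin n) → sum h ≡ h v + sum (delete v h)
sum-delete h v = begin
  sum h                                          ≡⟨ sum-cong-≗ split ⟩
  sum (λ u → δ v u (h v) + delete v h u)         ≡⟨ ∑-distrib-+ (λ u → δ v u (h v)) (delete v h) ⟩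
  sum (λ u → δ v u (h v)) + sum (delete v h)     ≡⟨ cong (_+ sum (delete v h)) (sum-δ v (h v)) ⟩
  h v + sum (delete v h)                         ∎
  where
  open ≡-Reasoning
  split : ∀ u → h u ≡ δ v u (h v) + delete v h u
  split u with u ≟ v
  ... | yes refl = ≡-sym (trans (+-identityʳ _) (δ-refl u (h u)))
  ... | no u≢v   = cong (_+ h u) (≡-sym (δ-≢ (h v) (u≢v ∘ ≡-sym)))

sum-≥₁ : (h : Fin n → ℕ) (v : Fin n) → h v ≤ sum h
sum-≥₁ h v = ≤-trans (m≤m+n (h v) _) (≤-reflexive (≡-sym (sum-delete h v)))

sum-≥₂ : (h : Fin n → ℕ) {u v : Fin n} → u ≢ v → h v + h u ≤ sum h
sum-≥₂ h {u} {v} u≢v = ≤-trans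
  (+-monoʳ-≤ (h v) (≤-trans (≤-reflexive (≡-sym (delete-≢ h u≢v))) (sum-≥₁ (delete v h) u)))
  (≤-reflexive (≡-sym (sum-delete h v)))

sum-≥₃ : (h : Fin n → ℕ) {u v w : Fin n} → u ≢ v → w ≢ v → w ≢ u → h v + (h u + h w) ≤ sum h
sum-≥₃ h {u} {v} {w} u≢v w≢v w≢u = ≤-trans
  (+-monoʳ-≤ (h v) (≤-trans
    (≤-reflexive (≡-sym (cong₂ _+_ (delete-≢ h u≢v) (delete-≢ h w≢v))))
    (sum-≥₂ (delete v h) w≢u)))
  (≤-reflexive (≡-sym (sum-delete h v)))

sum-≥₄ : (h : Fin n → ℕ) {u v w x : Fin n} → u ≢ v → w ≢ v → x ≢ v → w ≢ u → x ≢ u → x ≢ w →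
  h v + (h u + (h w + h x)) ≤ sum h
sum-≥₄ h {u} {v} {w} {x} u≢v w≢v x≢v w≢u x≢u x≢w = ≤-trans
  (+-monoʳ-≤ (h v) (≤-trans
    (≤-reflexive (≡-sym (cong₂ _+_ (delete-≢ h u≢v) (cong₂ _+_ (delete-≢ h w≢v) (delete-≢ h x≢v)))))
    (sum-≥₃ (delete v h) w≢u x≢u x≢w)))
  (≤-reflexive (≡-sym (sum-delete h v)))

-- Finite search

least : {P : ℕ → Set} → Decidable P → ∀ k → P k → ∃[ m ] (P m × m ≤ k × (∀ j → P j → m ≤ j))
least {P} P? zero    p = zero , p , z≤n , λ _ _ → z≤n
least {P} P? (suc k) p with P? 0
... | yes p₀ = zero , p₀ , z≤n , λ _ _ → z≤n
... | no ¬p₀ with least (λ j → P? (suc j)) k p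
...   | m , pm , m≤k , min = suc m , pm , s≤s m≤k , minimal
  where
  minimal : ∀ j → P j → suc m ≤ j
  minimal zero    p₀ = contradiction p₀ ¬p₀
  minimal (suc j) pj = s≤s (min j pj)

without : Fin n → List (Fin n) → List (Fin n)
without v = filter (λ u → ¬? (u ≟ v))

∈-without⁺ : {u v : Fin n} {xs : List (Fin n)} → u ∈ xs → u ≢ v → u ∈ without v xs
∈-without⁺ {v = v} = ∈-filter⁺ (λ u → ¬? (u ≟ v))

∈-without⁻ : {u v : Fin n} {xs : List (Fin n)} → u ∈ without v xs → u ∈ xs × u ≢ v
∈-without⁻ {v = v} {xs} = ∈-filter⁻ (λ u → ¬? (u ≟ v)) {xs = xs}

length-without : {v : Fin n} (xs : List (Fin n)) → v ∈ xs → length (without v xs) < length xs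
length-without {v = v} xs v∈xs =
  filter-notAll (λ u → ¬? (u ≟ v)) xs (Any.map (λ v≡u u≢v → u≢v (≡-sym v≡u)) v∈xs)

module MinimalCover (C : Fin n → Fin n → Set) (C? : ∀ u v → Dec (C u v))
  (U : Fin n → Set) (U? : Decidable U) where

  Covers : List (Fin n) → Set
  Covers xs = ∀ u → U u → ∃[ v ] (v ∈ xs × C u v)

  covers? : Decidable Covers
  covers? xs = all? λ u → U? u →-dec any? λ v → _∈?_ _≟_ v xs ×-dec C? u v

  Minimal : List (Fin n) → Set
  Minimal xs = ∀ v → v ∈ xs → ∃[ u ] (U u × C u v × (∀ v′ → v′ ∈ xs → v′ ≢ v → ¬ C u v′))

  -- Discard elements whose removal leaves a cover until none remains; `k` serves termination.
  -- Irreducibility then hands each surviving `v` an element of `U` that no other survivor covers.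
  shrink : ∀ k xs → length xs ≤ k → Covers xs →
    ∃[ ys ] ((∀ v → v ∈ ys → v ∈ xs) × Covers ys × Minimal ys)
  shrink k xs len cov with any? (λ v → _∈?_ _≟_ v xs ×-dec covers? (without v xs))
  shrink zero [] len cov | yes (v , () , _)
  shrink (suc k) xs len cov | yes (v , v∈xs , cov′)
    with shrink k (without v xs) (≤-pred (≤-trans (length-without xs v∈xs) len)) cov′
  ... | ys , ys⊆ , covers , minimal =
    ys , (λ u u∈ys → proj₁ (∈-without⁻ (ys⊆ u u∈ys))) , covers , minimal
  shrink k xs len cov | no irreducible = xs , (λ _ v∈ → v∈) , cov , minimal
    where
    minimal : Minimal xs
    minimal v v∈xs
      with ¬∀⟶∃¬ _ _ (λ u → U? u →-dec any? λ v′ → _∈?_ _≟_ v′ (without v xs) ×-dec C? u v′)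
             (λ cov′ → irreducible (v , v∈xs , cov′))
    ... | u , ¬cov = u , Uu , Cuv , private′
      where
      Uu : U u
      Uu = decidable-stable (U? u) (λ ¬Uu → ¬cov (λ Uu → contradiction Uu ¬Uu))
      private′ : ∀ v′ → v′ ∈ xs → v′ ≢ v → ¬ C u v′
      private′ v′ v′∈xs v′≢v c = ¬cov (λ _ → v′ , ∈-without⁺ v′∈xs v′≢v , c)
      Cuv : C u v
      Cuv with cov u Uu
      ... | v′ , v′∈xs , c with v′ ≟ v
      ...   | yes refl = c
      ...   | no v′≢v  = contradiction c (private′ v′ v′∈xs v′≢v)

-- Distances and balls

module Distance (G : Graph n) where

  D : Fin n → Fin n → ℕ → Set
  D = Dist≤ G

  walk-++ : ∀ {u v w a b} → Walk G u v a → Walk G v w b → Walk G u w (a + b)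
  walk-++ nil        q = q
  walk-++ (cons e p) q = cons e (walk-++ p q)

  walk-reverse : ∀ {u v a} → Walk G u v a → Walk G v u a
  walk-reverse nil = nil
  walk-reverse {a = suc a} (cons {u} {w} e p) =
    subst (Walk G _ _) (+-comm a 1)
      (walk-++ (walk-reverse p) (cons (trans (Graph.sym G w u) e) nil))

  walk? : ∀ u v a → Dec (Walk G u v a)
  walk? u v zero    = map′ (λ { refl → nil }) (λ { nil → refl }) (u ≟ v)
  walk? u v (suc a) = map′ (λ { (w , e , p) → cons e p }) (λ { (cons e p) → _ , e , p })
    (any? (λ w → (adj G u w Bool.≟ true) ×-dec walk? w v a))

  D? : ∀ u v k → Dec (D u v k)
  D? u v k = map′ (λ { (m , s≤s m≤k , p) → m , m≤k , p }) (λ { (m , m≤k , p) → m , s≤s m≤k , p })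
    (anyUpTo? (walk? u v) (suc k))

  D-refl : ∀ {u k} → D u u k
  D-refl = 0 , z≤n , nil

  D-sym : ∀ {u v k} → D u v k → D v u k
  D-sym (m , m≤k , p) = m , m≤k , walk-reverse p

  D-trans : ∀ {u v w a b} → D u v a → D v w b → D u w (a + b)
  D-trans (m , m≤a , p) (m′ , m′≤b , q) = m + m′ , +-mono-≤ m≤a m′≤b , walk-++ p q

  D-mono : ∀ {u v a b} → a ≤ b → D u v a → D u v b
  D-mono a≤b (m , m≤a , p) = m , ≤-trans m≤a a≤b , p

  D-adj : ∀ {u v} → adj G u v ≡ true → D u v 1
  D-adj e = 1 , ≤-refl , cons e nil

  D-zero : ∀ {u v} → D u v 0 → u ≡ v
  D-zero (.0 , z≤n , nil) = refl

  -- A walk that ends before `a` steps is split at its endpoint.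
  D-split : ∀ a {b u v} → D u v (a + b) → ∃[ p ] (D u p a × D p v b)
  D-split zero    d = _ , D-refl , d
  D-split (suc a) (zero , m≤ , nil) = _ , D-refl , D-refl
  D-split (suc a) (suc m , s≤s m≤ , cons e p) with D-split a (m , m≤ , p)
  ... | q , (k , k≤a , p₁) , d₂ = q , (suc k , s≤s k≤a , cons e p₁) , d₂

  D-split′ : ∀ {u v c} a b → c ≤ a + b → D u v c → ∃[ p ] (D u p a × D p v b)
  D-split′ a b c≤ d = D-split a (D-mono c≤ d)

  reach : ∀ {y v c R} r e → D y v r → D v c e → r + e ≤ R → D y c R
  reach r e d₁ d₂ r+e≤R = D-mono r+e≤R (D-trans d₁ d₂)

  exact : ∀ {u v k} → D u v k → ∃[ d ] (IsDist G u v d × d ≤ k)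
  exact {u} {v} {k} duv with least (D? u v) k duv
  ... | d , dd , d≤k , min = d , (dd , min) , d≤k

  -- The vertex `u` is in the component of `v` but farther than `k`. This is how a radius raised to
  -- `suc k` is seen to respect the eccentricity.
  ecc-> : ∀ {u v k e} → ¬ D u v k → ∀ {m} → D u v m → IsEcc G v e → k < e
  ecc-> {k = k} ¬d d (bound , _) with exact (D-sym d)
  ... | d′ , isd , _ = ≤-trans (≰⇒> λ d′≤k → ¬d (D-mono d′≤k (D-sym (proj₁ isd)))) (bound _ d′ isd)

  dominated? : ∀ g u → Dec (Dominated G g u)
  dominated? g u = any? λ v → (0 <? g v) ×-dec D? u v (g v)

  dominated-mono : ∀ {g h y} → (∀ v → g v ≤ h v) → Dominated G g y → Dominated G h y
  dominated-mono g≤h (v , 0<gv , d) = v , ≤-trans 0<gv (g≤h v) , D-mono (g≤h v) d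

  inPB? : ∀ g v u → Dec (InPB G g v u)
  inPB? g v u = D? u v (g v) ×-dec ¬? (dominated? (decAt G g v) u)

  decAt-≡ : ∀ g v → decAt G g v v ≡ g v ∸ 1
  decAt-≡ g v with v ≟ v
  ... | yes _  = refl
  ... | no v≢v = contradiction refl v≢v

  decAt-≢ : ∀ g {v w} → w ≢ v → decAt G g v w ≡ g w
  decAt-≢ g {v} {w} w≢v with w ≟ v
  ... | yes w≡v = contradiction w≡v w≢v
  ... | no _    = refl

  ball : Fin n → ℕ → Fin n → ℕ
  ball c r u = δ c u r

  dominated-ball : ∀ {c r y} → 0 < r → D y c r → Dominated G (ball c r) y
  dominated-ball {c} {r} 0<r d =
    c , subst (0 <_) (≡-sym (δ-refl c r)) 0<r , subst (D _ c) (≡-sym (δ-refl c r)) d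

  _⊕_ : (Fin n → ℕ) → (Fin n → ℕ) → Fin n → ℕ
  (g ⊕ h) v = g v + h v

  dominated-⊕ˡ : ∀ {g h y} → Dominated G g y → Dominated G (g ⊕ h) y
  dominated-⊕ˡ {g} {h} = dominated-mono λ v → m≤m+n (g v) (h v)

  dominated-⊕ʳ : ∀ {g h y} → Dominated G h y → Dominated G (g ⊕ h) y
  dominated-⊕ʳ {g} {h} = dominated-mono λ v → m≤n+m (h v) (g v)

  sum-⊕ : ∀ g h → sum (g ⊕ h) ≡ sum g + sum h
  sum-⊕ = ∑-distrib-+

  sum-tabulate : ∀ {m} (g : Fin m → ℕ) → ListAction.sum (List.tabulate g) ≡ sum g
  sum-tabulate {zero}  g = refl
  sum-tabulate {suc m} g = cong (g fzero +_) (sum-tabulate (λ v → g (fsuc v)))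

  σ≡sum : ∀ g → σ G g ≡ sum g
  σ≡sum g = trans (cong ListAction.sum (map-tabulate id g)) (sum-tabulate g)

  -- Any radius can be lowered to the least one giving the same ball; this respects eccentricities.
  module _ (noIsolated : NoIsolated G) where

    truncate : ∀ g → (∀ u → Dominated G g u) →
      ∃[ h ] (IsBroadcast G h × IsDominating G h × σ G h ≤ sum g)
    truncate g dom = h , broadcast , dominating ,
      ≤-trans (≤-reflexive (σ≡sum h)) (sum-mono λ v → proj₁ (proj₂ (proj₂ (radius v))))
      where
      Same : Fin n → ℕ → Set
      Same v k = ∀ u → D u v (g v) → D u v k
      radius : ∀ v → ∃[ k ] (Same v k × k ≤ g v × (∀ j → Same v j → k ≤ j))
      radius v = least (λ k → all? λ u → D? u v (g v) →-dec D? u v k) (g v) (λ _ d → d)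
      h : Fin n → ℕ
      h v = proj₁ (radius v)
      broadcast : IsBroadcast G h
      broadcast v e (bound , _) = proj₂ (proj₂ (proj₂ (radius v))) e λ u d →
        let d′ , isd , _ = exact (D-sym d)
        in D-mono (bound u d′ isd) (D-sym (proj₁ isd))
      -- Domination ignores vertices of value zero, so positivity must survive: a neighbour of `v`
      -- lies in the old ball, hence radius zero cannot give the same ball.
      positive : ∀ v → 0 < g v → 0 < h v
      positive v 0<gv with noIsolated v
      ... | u , e = n≢0⇒n>0 λ hv≡0 →
        let u≡v = D-zero (subst (D u v) hv≡0
                    (proj₁ (proj₂ (radius v)) u (D-sym (D-mono 0<gv (D-adj e)))))
        in contradiction (trans (≡-sym (irrefl G v)) (subst (λ w → adj G v w ≡ true) u≡v e)) λ ()
      dominating : IsDominating G h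
      dominating u with dom u
      ... | v , 0<gv , d = v , positive v 0<gv , proj₁ (proj₂ (radius v)) u d

-- Consequences of maximality and the choice of the boosted set

module _ (G : Graph n) (noIsolated : NoIsolated G)
  (f : Fin n → ℕ) (maximal : IsMaximalIrredundant G f) where

  open Distance G

  Undominated : Fin n → Set
  Undominated u = ¬ Dominated G f u

  undominated-far : ∀ {u v} → Undominated u → 0 < f v → ¬ D u v (f v)
  undominated-far ¬dom 0<fv d = ¬dom (_ , 0<fv , d)

  boost : List (Fin n) → Fin n → ℕ
  boost T v = if does (_∈?_ _≟_ v T) then suc (f v) else f v

  boost-∈ : ∀ T {v} → v ∈ T → boost T v ≡ suc (f v)
  boost-∈ T {v} v∈T with _∈?_ _≟_ v T
  ... | yes _  = refl
  ... | no v∉T = contradiction v∈T v∉T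

  boost-∉ : ∀ T {v} → v ∉ T → boost T v ≡ f v
  boost-∉ T {v} v∉T with _∈?_ _≟_ v T
  ... | yes v∈T = contradiction v∈T v∉T
  ... | no _    = refl

  boost-≥ : ∀ T v → f v ≤ boost T v
  boost-≥ T v with _∈?_ _≟_ v T
  ... | yes _ = n≤1+n (f v)
  ... | no _  = ≤-refl

  boost-≤ : ∀ T v → boost T v ≤ suc (f v)
  boost-≤ T v with _∈?_ _≟_ v T
  ... | yes _ = ≤-refl
  ... | no _  = n≤1+n (f v)

  PrivatelyReaches : List (Fin n) → Fin n → Set
  PrivatelyReaches T v =
    ∃[ u ] (Undominated u × D u v (suc (f v)) × (∀ v′ → v′ ∈ T → v′ ≢ v → ¬ D u v′ (suc (f v′))))

  -- Lowering `v` by one returns it to `f v`, which misses the undominated `u`. Vertices outside `T`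
  -- miss `u` for the same reason, the other members of `T` by privacy.
  boost-InPB : ∀ T {v} → v ∈ T → PrivatelyReaches T v → ∃[ u ] InPB G (boost T) v u
  boost-InPB T {v} v∈T (u , ¬dom , d , priv) =
    u , subst (D u v) (≡-sym (boost-∈ T v∈T)) d , undominated
    where
    undominated : ¬ Dominated G (decAt G (boost T) v) u
    undominated (z , 0<z , dz) with z ≟ v
    ... | yes refl = ¬dom (z , subst (λ k → 0 < k ∸ 1) (boost-∈ T v∈T) 0<z
                             , subst (λ k → D u z (k ∸ 1)) (boost-∈ T v∈T) dz)
    ... | no z≢v with _∈?_ _≟_ z T
    ...   | yes z∈T = priv z z∈T z≢v dz
    ...   | no z∉T  = ¬dom (z , 0<z , dz)

  -- By `far` the boosted function is a broadcast, so maximality makes it redundant at some `x`.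
  -- Members of `T` keep a private witness, so `x` is outside `T` and keeps its radius; only a
  -- boosted ball can then have taken over a vertex of its private boundary.
  boost-kills : ∀ T → (∃[ v ] v ∈ T) →
    (∀ v → v ∈ T → ∃[ p ] (¬ D p v (f v) × D p v (suc (f v)))) →
    (∀ v → v ∈ T → PrivatelyReaches T v) →
    ∃[ x ] (0 < f x × x ∉ T × (∀ y → InPB G f x y → ∃[ v ] (v ∈ T × D y v (suc (f v)))))
  boost-kills T (v₀ , v₀∈T) far priv
    with ¬∀⟶∃¬ n _ (λ v → (0 <? boost T v) →-dec any? (inPB? (boost T) v))
           (proj₂ (proj₂ maximal) (boost T) broadcast
             (boost-≥ T , v₀ , ≤-reflexive (≡-sym (boost-∈ T v₀∈T))))
    where
    broadcast : IsBroadcast G (boost T)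
    broadcast v e ecc with _∈?_ _≟_ v T
    ... | yes v∈T = let p , ¬d , d = far v v∈T in ecc-> ¬d d ecc
    ... | no _    = proj₁ maximal v e ecc
  ... | x , redundant = x , 0<fx , x∉T , killed
    where
    x∉T : x ∉ T
    x∉T x∈T = redundant λ _ → boost-InPB T x∈T (priv x x∈T)
    0<fx : 0 < f x
    0<fx = subst (0 <_) (boost-∉ T x∉T)
      (decidable-stable (0 <? boost T x) λ ¬pos → redundant λ pos → contradiction pos ¬pos)
    killed : ∀ y → InPB G f x y → ∃[ v ] (v ∈ T × D y v (suc (f v)))
    killed y (d , ¬dom) with dominated? (decAt G (boost T) x) y
    ... | no ¬dom′ = contradiction
      (λ _ → y , subst (D y x) (≡-sym (boost-∉ T x∉T)) d , ¬dom′) redundant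
    ... | yes (z , 0<z , dz) with z ≟ x
    ...   | yes refl = contradiction
      (z , subst (0 <_) eq 0<z , subst (D y z) eq dz) ¬dom
      where
      eq : boost T z ∸ 1 ≡ decAt G f z z
      eq = trans (cong (_∸ 1) (boost-∉ T x∉T)) (≡-sym (decAt-≡ f z))
    ...   | no z≢x with _∈?_ _≟_ z T
    ...     | yes z∈T = z , z∈T , dz
    ...     | no z∉T  = contradiction
      (z , subst (0 <_) (≡-sym (decAt-≢ f z≢x)) 0<z
         , subst (D y z) (≡-sym (decAt-≢ f z≢x)) dz) ¬dom

  Annihilated : Fin n → Set
  Annihilated v = ∃[ u ] (Undominated u × (∀ y → InPB G f v y → D y u 1))

  -- `boost-kills` is applied to `u` alone. Since `f u` is zero, the boosted ball is the closed
  -- neighbourhood of `u`, and a neighbour of `u` makes radius one legal.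
  undominated-annihilates : ∀ u → Undominated u →
    ∃[ v ] (0 < f v × (∀ y → InPB G f v y → D y u 1))
  undominated-annihilates u ¬dom
    with boost-kills (u ∷ []) (u , here refl) far priv
    where
    fu≡0 : f u ≡ 0
    fu≡0 with f u in eq
    ... | zero  = refl
    ... | suc k = contradiction (u , subst (0 <_) (≡-sym eq) (s≤s z≤n) , D-refl) ¬dom
    far : ∀ v → v ∈ u ∷ [] → ∃[ p ] (¬ D p v (f v) × D p v (suc (f v)))
    far .u (here refl) with noIsolated u
    ... | p , e = p
      , (λ d → contradiction
          (trans (≡-sym (irrefl G u))
            (subst (λ w → adj G u w ≡ true) (D-zero (subst (D p u) fu≡0 d)) e)) λ ())
      , D-mono (s≤s z≤n) (D-sym (D-adj e))
    priv : ∀ v → v ∈ u ∷ [] → PrivatelyReaches (u ∷ []) v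
    priv .u (here refl) = u , ¬dom , D-refl , λ { _ (here refl) v′≢v → contradiction refl v′≢v }
  ... | x , 0<fx , _ , killed = x , 0<fx , λ y pb → near y (killed y pb)
    where
    fu≤0 : f u ≤ 0
    fu≤0 = ≮⇒≥ λ 0<fu → ¬dom (u , 0<fu , D-refl)
    near : ∀ y → ∃[ v ] (v ∈ u ∷ [] × D y v (suc (f v))) → D y u 1
    near y (.u , here refl , d) = D-mono (s≤s fu≤0) d

  record BoostSet : Set where
    field
      S           : List (Fin n)
      positive    : ∀ v → v ∈ S → 0 < f v
      annihilated : ∀ v → v ∈ S → Annihilated v
      covering    : ∀ u → Undominated u → ∃[ v ] (v ∈ S × D u v (suc (f v)))
      minimal     : ∀ v → v ∈ S → PrivatelyReaches S v

  -- If the private boundary of `v` lies in the closed neighbourhood of `u`, any of its elements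
  -- joins `v` to `u` within `f v + 1`. So all annihilated vertices together cover the undominated
  -- ones, and a minimal subcover is taken.
  boostSet : BoostSet
  boostSet = record
    { S           = proj₁ cover
    ; positive    = λ v v∈S → proj₁ (spec v v∈S)
    ; annihilated = λ v v∈S → proj₂ (spec v v∈S)
    ; covering    = proj₁ (proj₂ (proj₂ cover))
    ; minimal     = proj₂ (proj₂ (proj₂ cover))
    }
    where
    open MinimalCover (λ u v → D u v (suc (f v))) (λ u v → D? u v (suc (f v)))
      Undominated (λ u → ¬? (dominated? f u))
    candidate? : ∀ v → Dec (0 < f v × Annihilated v)
    candidate? v = (0 <? f v) ×-dec any? λ u →
      ¬? (dominated? f u) ×-dec all? λ y → inPB? f v y →-dec D? y u 1
    candidates : List (Fin n)
    candidates = filter candidate? (allFin n)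
    covers : Covers candidates
    covers u ¬dom =
      let v , 0<fv , near = undominated-annihilates u ¬dom
          y , pb = proj₁ (proj₂ maximal) v 0<fv
      in v , ∈-filter⁺ candidate? (∈-allFin v) (0<fv , u , ¬dom , near)
           , D-trans (D-sym (near y pb)) (proj₁ pb)
    cover : ∃[ ys ] ((∀ v → v ∈ ys → v ∈ candidates) × Covers ys × Minimal ys)
    cover = shrink (length candidates) candidates ≤-refl covers
    spec : ∀ v → v ∈ proj₁ cover → 0 < f v × Annihilated v
    spec v v∈S = proj₂ (∈-filter⁻ candidate? {xs = allFin n} (proj₁ (proj₂ cover) v v∈S))

  -- Clusters of overlapping balls

  mass : (Fin n → Fin n) → Fin n → ℕ
  mass ℓ a = sum λ v → δ (ℓ v) a (f v)

  sum-mass : ∀ ℓ → sum (mass ℓ) ≡ sum f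
  sum-mass ℓ = trans (∑-comm (λ a v → δ (ℓ v) a (f v))) (sum-cong-≗ λ v → sum-δ (ℓ v) (f v))

  mass-mono : ∀ {ℓ ℓ′ a a′} → (∀ v → ℓ v ≡ a → ℓ′ v ≡ a′) → mass ℓ a ≤ mass ℓ′ a′
  mass-mono {ℓ} {ℓ′} {a} {a′} imp = sum-mono pointwise
    where
    pointwise : ∀ v → δ (ℓ v) a (f v) ≤ δ (ℓ′ v) a′ (f v)
    pointwise v with ℓ v ≟ a
    ... | no _    = z≤n
    ... | yes eq  with ℓ′ v ≟ a′
    ...   | yes _ = ≤-refl
    ...   | no ¬p = contradiction (imp v eq) ¬p

  private
    δ-at : ∀ {ℓ : Fin n → Fin n} {a v} → ℓ v ≡ a → δ (ℓ v) a (f v) ≡ f v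
    δ-at {ℓ} {v = v} refl = δ-refl (ℓ v) (f v)

  mass-≥₁ : ∀ {ℓ a v} → ℓ v ≡ a → f v ≤ mass ℓ a
  mass-≥₁ {ℓ} {a} {v} eq = ≤-trans (≤-reflexive (≡-sym (δ-at {ℓ} eq))) (sum-≥₁ _ v)

  mass-≥₂ : ∀ {ℓ a u v} → ℓ v ≡ a → ℓ u ≡ a → u ≢ v → f v + f u ≤ mass ℓ a
  mass-≥₂ {ℓ} v∈ u∈ u≢v = ≤-trans
    (≤-reflexive (≡-sym (cong₂ _+_ (δ-at {ℓ} v∈) (δ-at {ℓ} u∈)))) (sum-≥₂ _ u≢v)

  mass-≥₃ : ∀ {ℓ a u v w} → ℓ v ≡ a → ℓ u ≡ a → ℓ w ≡ a → u ≢ v → w ≢ v → w ≢ u →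
    f v + (f u + f w) ≤ mass ℓ a
  mass-≥₃ {ℓ} v∈ u∈ w∈ u≢v w≢v w≢u = ≤-trans
    (≤-reflexive (≡-sym (cong₂ _+_ (δ-at {ℓ} v∈) (cong₂ _+_ (δ-at {ℓ} u∈) (δ-at {ℓ} w∈)))))
    (sum-≥₃ _ u≢v w≢v w≢u)

  mass-≥₄ : ∀ {ℓ a u v w x} → ℓ v ≡ a → ℓ u ≡ a → ℓ w ≡ a → ℓ x ≡ a →
    u ≢ v → w ≢ v → x ≢ v → w ≢ u → x ≢ u → x ≢ w → f v + (f u + (f w + f x)) ≤ mass ℓ a
  mass-≥₄ {ℓ} v∈ u∈ w∈ x∈ u≢v w≢v x≢v w≢u x≢u x≢w = ≤-trans
    (≤-reflexive (≡-sym (cong₂ _+_ (δ-at {ℓ} v∈) (cong₂ _+_ (δ-at {ℓ} u∈)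
      (cong₂ _+_ (δ-at {ℓ} w∈) (δ-at {ℓ} x∈))))))
    (sum-≥₄ _ u≢v w≢v x≢v w≢u x≢u x≢w)

  relabel : Fin n → Fin n → Fin n → Fin n
  relabel a b c = if does (c ≟ a) then b else c

  relabel-≡ : ∀ a b → relabel a b a ≡ b
  relabel-≡ a b with a ≟ a
  ... | yes _  = refl
  ... | no a≢a = contradiction refl a≢a

  relabel-≢ : ∀ {a b c} → c ≢ a → relabel a b c ≡ c
  relabel-≢ {a} {b} {c} c≢a with c ≟ a
  ... | yes c≡a = contradiction c≡a c≢a
  ... | no _    = refl

  mass-relabel : ∀ {ℓ a b} → a ≢ b → mass ℓ a + mass ℓ b ≡ mass (relabel a b ∘ ℓ) b
  mass-relabel {ℓ} {a} {b} a≢b = trans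
    (≡-sym (∑-distrib-+ (λ v → δ (ℓ v) a (f v)) (λ v → δ (ℓ v) b (f v))))
    (sum-cong-≗ pointwise)
    where
    pointwise : ∀ v → δ (ℓ v) a (f v) + δ (ℓ v) b (f v) ≡ δ (relabel a b (ℓ v)) b (f v)
    pointwise v with ℓ v ≟ a
    ... | yes refl = trans (cong (f v +_) (δ-≢ (f v) a≢b))
                       (trans (+-identityʳ (f v)) (≡-sym (δ-refl b (f v))))
    ... | no _     = refl

  -- Two balls that meet lie in a ball whose radius is the sum of the two radii.
  merge : ∀ {c c′} r r′ → D c c′ (r + r′) → ∃[ m ] (D c m r′ × D c′ m r)
  merge r r′ d with D-split′ r′ r (≤-reflexive (+-comm r r′)) d
  ... | m , d₁ , d₂ = m , d₁ , D-sym d₂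

  Touch : Fin n → Fin n → Set
  Touch v x = 0 < f v × 0 < f x × D v x (f v + f x)

  -- A union-find state: `pairs` lists the pairs already processed, and labels are vertices. Keeping
  -- the distance bound `e` in `centred` lets the estimate be reused when `f v` and the mass are
  -- both raised by one.
  record Clustering (pairs : List (Fin n × Fin n)) : Set where
    field
      ℓ         : Fin n → Fin n
      centre    : Fin n → Fin n
      centred   : ∀ v → 0 < f v → ∃[ e ] (D v (centre (ℓ v)) e × f v + e ≤ mass ℓ (ℓ v))
      separated : ∀ {v x} → (v , x) ∈ pairs → Touch v x → ℓ v ≡ ℓ x

  clustering : ∀ pairs → Clustering pairs
  clustering [] = record
    { ℓ         = id
    ; centre    = id
    ; centred   = λ v _ → 0 , D-refl , ≤-trans (≤-reflexive (+-identityʳ (f v))) (mass-≥₁ {id} refl)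
    ; separated = λ ()
    }
  clustering ((p , q) ∷ pairs) with clustering pairs
  ... | C with (0 <? f p) ×-dec (0 <? f q) ×-dec D? p q (f p + f q)
             | Clustering.ℓ C p ≟ Clustering.ℓ C q
  ... | no ¬touch | _ = record
    { ℓ         = ℓ
    ; centre    = centre
    ; centred   = centred
    ; separated = λ { (here refl) t → contradiction t ¬touch ; (there i) t → separated i t }
    }
    where open Clustering C
  ... | yes _ | yes same = record
    { ℓ         = ℓ
    ; centre    = centre
    ; centred   = centred
    ; separated = λ { (here refl) _ → same ; (there i) t → separated i t }
    }
    where open Clustering C
  ... | yes (0<p , 0<q , dpq) | no a≢b = record
    { ℓ         = relabel a b ∘ ℓ
    ; centre    = λ c → if does (c ≟ b) then m else centre c
    ; centred   = centred′
    ; separated = λ { (here refl) _ → trans (relabel-≡ a b) (≡-sym (relabel-≢ (a≢b ∘ ≡-sym)))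
                    ; (there i) t → cong (relabel a b) (separated i t) }
    }
    where
    open Clustering C
    a b : Fin n
    a = ℓ p
    b = ℓ q
    -- The route runs from one centre through `p` and `q` to the other.
    meet : D (centre a) (centre b) (mass ℓ a + mass ℓ b)
    meet with centred p 0<p | centred q 0<q
    ... | e₁ , d₁ , le₁ | e₂ , d₂ , le₂ =
      D-mono (≤-trans (≤-reflexive rearranged) (+-mono-≤ le₁ le₂))
        (D-trans (D-trans (D-sym d₁) dpq) d₂)
      where
      rearranged : e₁ + (f p + f q) + e₂ ≡ f p + e₁ + (f q + e₂)
      rearranged = trans (cong (_+ e₂) (trans (≡-sym (+-assoc e₁ (f p) (f q)))
                     (cong (_+ f q) (+-comm e₁ (f p)))))
                     (+-assoc (f p + e₁) (f q) e₂)
    m : Fin n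
    m = proj₁ (merge (mass ℓ a) (mass ℓ b) meet)
    am : D (centre a) m (mass ℓ b)
    am = proj₁ (proj₂ (merge (mass ℓ a) (mass ℓ b) meet))
    bm : D (centre b) m (mass ℓ a)
    bm = proj₂ (proj₂ (merge (mass ℓ a) (mass ℓ b) meet))
    total : mass ℓ a + mass ℓ b ≡ mass (relabel a b ∘ ℓ) b
    total = mass-relabel {ℓ} a≢b
    centre′ : Fin n → Fin n
    centre′ c = if does (c ≟ b) then m else centre c
    centre′-b : centre′ b ≡ m
    centre′-b with b ≟ b
    ... | yes _  = refl
    ... | no b≢b = contradiction refl b≢b
    Centred : Fin n → Fin n → Set
    Centred v c = ∃[ e ] (D v (centre′ c) e × f v + e ≤ mass (relabel a b ∘ ℓ) c)
    -- Moving a centre costs a member at most the mass of the other cluster, which is exactly what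
    -- the mass of its own cluster gains.
    centred′ : ∀ v → 0 < f v → Centred v (relabel a b (ℓ v))
    centred′ v 0<v with centred v 0<v | ℓ v ≟ a
    ... | e , d , le | yes eq = e + mass ℓ b
      , subst (λ c → D v c (e + mass ℓ b)) (≡-sym centre′-b)
          (D-trans (subst (λ c → D v (centre c) e) eq d) am)
      , ≤-trans (≤-reflexive (≡-sym (+-assoc (f v) e _)))
          (≤-trans (+-monoˡ-≤ (mass ℓ b) (subst (λ c → f v + e ≤ mass ℓ c) eq le))
            (≤-reflexive total))
    ... | e , d , le | no ≢a with ℓ v ≟ b
    ...   | yes eq = e + mass ℓ a
      , D-trans (subst (λ c → D v (centre c) e) eq d) bm
      , ≤-trans (≤-reflexive (≡-sym (+-assoc (f v) e _)))
          (≤-trans (+-monoˡ-≤ (mass ℓ a) (subst (λ c → f v + e ≤ mass ℓ c) eq le))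
            (≤-trans (≤-reflexive (trans (+-comm (mass ℓ b) (mass ℓ a)) total))
              (≤-reflexive (cong (mass (relabel a b ∘ ℓ)) (≡-sym eq)))))
    ...   | no ≢b = e , d
      , ≤-trans le (mass-mono {ℓ} {relabel a b ∘ ℓ}
          λ u eq → trans (relabel-≢ λ ua → ≢a (trans (≡-sym eq) ua)) eq)

  -- Domination inside one cluster

  module _ (B : BoostSet) (C : Clustering (cartesianProduct (allFin n) (allFin n))) where

    open BoostSet B
    open Clustering C

    ρ : Fin n → ℕ
    ρ = mass ℓ

    r : Fin n → ℕ
    r = boost S

    Ω : Fin n → Set
    Ω y = ∃[ v ] (v ∈ S × D y v (suc (f v)))

    touching : ∀ {v x} → Touch v x → ℓ v ≡ ℓ x
    touching {v} {x} = separated (∈-cartesianProduct⁺ (∈-allFin v) (∈-allFin x))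

    overlapping : ∀ {v x y} → 0 < f v → 0 < f x → D y v (f v) → D y x (f x) → ℓ v ≡ ℓ x
    overlapping 0<v 0<x d₁ d₂ = touching (0<v , 0<x , D-trans (D-sym d₁) d₂)

    ¬InPB⇒dominated : ∀ {x y} → D y x (f x) → ¬ InPB G f x y → Dominated G (decAt G f x) y
    ¬InPB⇒dominated {x} {y} d ¬pb =
      decidable-stable (dominated? (decAt G f x) y) λ ¬dom → ¬pb (d , ¬dom)

    -- Another vertex dominating `y` has a ball meeting that of `x` in `y`, so it lies in the same
    -- cluster.
    dominated-decAt : ∀ {x y} → 0 < f x → D y x (f x) → Dominated G (decAt G f x) y →
      (0 < f x ∸ 1 × D y x (f x ∸ 1)) ⊎ ∃[ z ] (0 < f z × z ≢ x × ℓ z ≡ ℓ x × D y z (f z))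
    dominated-decAt {x} {y} 0<fx d (z , 0<z , dz) with z ≟ x
    ... | yes refl = inj₁ (0<z , dz)
    ... | no z≢x   = inj₂ (z , 0<z , z≢x , overlapping 0<z 0<fx dz d , dz)

    -- The private boundary of v lies in N[u] with u undominated, so it cannot contain v itself.
    neighbour : ∀ {v} → v ∈ S → f v ≡ 1 → ∃[ z ] (0 < f z × z ≢ v × ℓ z ≡ ℓ v × D v z (f z))
    neighbour {v} v∈S fv≡1 with annihilated v v∈S
    ... | u , ¬dom , near
        with dominated-decAt (positive v v∈S) D-refl (¬InPB⇒dominated D-refl λ pb →
               undominated-far ¬dom (positive v v∈S)
                 (D-mono (≤-reflexive (≡-sym fv≡1)) (D-sym (near v pb))))
    ...   | inj₁ (0<0 , _) = contradiction (subst (λ k → 0 < k ∸ 1) fv≡1 0<0) λ ()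
    ...   | inj₂ z = z

    mass-≥2 : ∀ {v} → v ∈ S → 2 ≤ ρ (ℓ v)
    mass-≥2 {v} v∈S with 2 ≤? f v
    ... | yes 2≤fv = ≤-trans 2≤fv (mass-≥₁ {ℓ} refl)
    ... | no 2≰fv with neighbour v∈S (≤-antisym (≤-pred (≰⇒> 2≰fv)) (positive v v∈S))
    ...   | z , 0<z , z≢v , eq , _ =
      ≤-trans (+-mono-≤ (positive v v∈S) 0<z) (mass-≥₂ {ℓ} refl eq z≢v)

    -- Clusters of mass at most three

    ones : ∀ {a b c} → 0 < a → 0 < b → 0 < c → a + (b + c) ≤ 3 → a ≡ 1 × b ≡ 1 × c ≡ 1
    ones {a} {b} {c} 0<a 0<b 0<c le =
        ≤-antisym (+-cancelʳ-≤ 2 a 1 (≤-trans (+-monoʳ-≤ a (+-mono-≤ 0<b 0<c)) le)) 0<a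
      , ≤-antisym (+-cancelʳ-≤ 1 b 1 (≤-trans (+-monoʳ-≤ b 0<c) b+c≤2)) 0<b
      , ≤-antisym (+-cancelˡ-≤ 1 c 1 (≤-trans (+-monoˡ-≤ c 0<b) b+c≤2)) 0<c
      where
      b+c≤2 : b + c ≤ 2
      b+c≤2 = +-cancelˡ-≤ 1 (b + c) 2 (≤-trans (+-monoˡ-≤ (b + c) 0<a) le)

    Member : Fin n → Fin n → Set
    Member v z = 0 < f z × ℓ z ≡ ℓ v

    Second : Fin n → Fin n → Set
    Second v x = Member v x × x ≢ v

    second? : ∀ v x → Dec (Second v x)
    second? v x = ((0 <? f x) ×-dec (ℓ x ≟ ℓ v)) ×-dec ¬? (x ≟ v)

    Third : Fin n → Fin n → Fin n → Set
    Third v x t = Second v t × t ≢ x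

    third? : ∀ v x t → Dec (Third v x t)
    third? v x t = second? v t ×-dec ¬? (t ≟ x)

    two-members : ∀ {v x} → ¬ ∃ (Third v x) → ∀ {z} → Member v z → z ≡ v ⊎ z ≡ x
    two-members {v} {x} none {z} mem with z ≟ v | z ≟ x
    ... | yes z≡v | _       = inj₁ z≡v
    ... | no _    | yes z≡x = inj₂ z≡x
    ... | no z≢v  | no z≢x  = contradiction (z , (mem , z≢v) , z≢x) none

    three-ones : ∀ {v x t} → 0 < f v → ρ (ℓ v) ≤ 3 → Second v x → Third v x t →
      f v ≡ 1 × f x ≡ 1 × f t ≡ 1
    three-ones 0<v ρ≤3 ((0<x , x∈) , x≢v) (((0<t , t∈) , t≢v) , t≢x) =
      ones 0<v 0<x 0<t (≤-trans (mass-≥₃ {ℓ} refl x∈ t∈ x≢v t≢v t≢x) ρ≤3)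

    three-members : ∀ {v x t} → 0 < f v → ρ (ℓ v) ≤ 3 → Second v x → Third v x t →
      ∀ {z} → Member v z → z ≡ v ⊎ z ≡ x ⊎ z ≡ t
    three-members {v} {x} {t} 0<v ρ≤3 ((0<x , x∈) , x≢v) (((0<t , t∈) , t≢v) , t≢x) {z} (0<z , z∈)
      with z ≟ v | z ≟ x | z ≟ t
    ... | yes z≡v | _       | _       = inj₁ z≡v
    ... | no _    | yes z≡x | _       = inj₂ (inj₁ z≡x)
    ... | no _    | no _    | yes z≡t = inj₂ (inj₂ z≡t)
    ... | no z≢v  | no z≢x  | no z≢t  = contradiction
      (≤-trans (+-mono-≤ 0<v (+-mono-≤ 0<x (+-mono-≤ 0<t 0<z)))
        (≤-trans (mass-≥₄ {ℓ} refl x∈ t∈ z∈ x≢v t≢v z≢v t≢x z≢x z≢t) ρ≤3))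
      λ { (s≤s (s≤s (s≤s ()))) }

    centre-near : ∀ {v z} → ρ (ℓ v) ≤ 3 → Member v z → ∀ {k} → f z ≡ k →
      D z (centre (ℓ v)) (3 ∸ k)
    centre-near {v} {z} ρ≤3 (0<z , z∈) refl =
      let e , d , le = centred z 0<z
      in D-mono (m+n≤o⇒m≤o∸n e (≤-trans (≤-reflexive (+-comm e (f z)))
                  (≤-trans (subst (λ a → f z + e ≤ ρ a) z∈ le) ρ≤3)))
           (subst (λ a → D z (centre a) e) z∈ d)

    -- A recentring of the cluster of `v`: radius `ρ (ℓ v)` about `c` reaches `w`, where another
    -- cluster is met, and one more unit holds all boosted balls. The unboosted balls are not
    -- claimed to fit in the smaller radius.
    Link : Fin n → Fin n → Set
    Link v w = ∃[ c ] (D w c (ρ (ℓ v)) ×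
      (∀ {z y} → Member v z → D y z (r z) → D y c (suc (ρ (ℓ v)))))

    -- With nothing else in its cluster, the whole boundary of v is private, hence has diameter
    -- at most two, and the boosted ball can be centred two steps from v towards w.
    link-single : ∀ {v w} → v ∈ S → ρ (ℓ v) ≤ 3 → D w v (suc (f v)) → ¬ D w v (f v) →
      ¬ ∃ (Second v) → Link v w
    link-single {v} {w} v∈S ρ≤3 dw ¬dw single = p
      , D-mono (≤-trans (≤-trans (n≤1+n (suc k)) (≤-reflexive 2+k≡fv)) fv≤ρ)
          (D-sym (D-trans′ dpw′ dw′w))
      , cover
      where
      0<v : 0 < f v
      0<v = positive v v∈S
      fv≤ρ : f v ≤ ρ (ℓ v)
      fv≤ρ = mass-≥₁ {ℓ} refl
      2≤fv : 2 ≤ f v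
      2≤fv = ≤∧≢⇒< 0<v λ 1≡fv →
        let z , 0<z , z≢v , z∈ , _ = neighbour v∈S (≡-sym 1≡fv)
        in single (z , (0<z , z∈) , z≢v)
      k : ℕ
      k = f v ∸ 2
      2+k≡fv : 2 + k ≡ f v
      2+k≡fv = m+[n∸m]≡n 2≤fv
      D-trans′ : ∀ {a b c i} → D a b i → D b c 1 → D a c (suc i)
      D-trans′ {i = i} d₁ d₂ = D-mono (≤-reflexive (+-comm i 1)) (D-trans d₁ d₂)
      to-w : ∃[ q ] (D v q (2 + k) × D q w 1)
      to-w = D-split′ (2 + k) 1
        (≤-reflexive (trans (cong suc (≡-sym 2+k≡fv)) (+-comm 1 (2 + k)))) (D-sym dw)
      w′ : Fin n
      w′ = proj₁ to-w
      dw′w : D w′ w 1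
      dw′w = proj₂ (proj₂ to-w)
      to-w′ : ∃[ q ] (D v q 2 × D q w′ k)
      to-w′ = D-split 2 (proj₁ (proj₂ to-w))
      p : Fin n
      p = proj₁ to-w′
      dvp : D v p 2
      dvp = proj₁ (proj₂ to-w′)
      dpw′ : D p w′ k
      dpw′ = proj₂ (proj₂ to-w′)
      -- A second ball through `b` would belong to the cluster of `v`, which has no other member.
      boundary : ∀ {b} → D b v (f v) → ¬ D b v (f v ∸ 1) → InPB G f v b
      boundary {b} d ¬d = decidable-stable (inPB? f v b) λ ¬pb → impossible
        (dominated-decAt 0<v d (¬InPB⇒dominated d ¬pb))
        where
        impossible : ¬ ((0 < f v ∸ 1 × D b v (f v ∸ 1))
                        ⊎ ∃[ z ] (0 < f z × z ≢ v × ℓ z ≡ ℓ v × D b z (f z)))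
        impossible (inj₁ (_ , d′)) = ¬d d′
        impossible (inj₂ (z , 0<z , z≢v , z∈ , _)) = single (z , (0<z , z∈) , z≢v)
      extend : ∀ {b y} → D b y 1 → D b v (f v ∸ 1) → D y v (f v)
      extend d₁ d₂ = D-mono (≤-reflexive (m+[n∸m]≡n 0<v)) (D-trans (D-sym d₁) d₂)
      u : Fin n
      u = proj₁ (annihilated v v∈S)
      near : ∀ y → InPB G f v y → D y u 1
      near = proj₂ (proj₂ (annihilated v v∈S))
      near-w′ : D w′ u 1
      near-w′ = near w′ (boundary (D-mono (≤-reflexive 2+k≡fv) (D-sym (proj₁ (proj₂ to-w))))
                          (¬dw ∘ extend dw′w))
      -- Both `b` and `w′` are within one of `u`, and `w′` is `f v ∸ 2` from `p`.
      boundary-near-p : ∀ {b} → InPB G f v b → D b p (f v)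
      boundary-near-p pb = D-mono (≤-reflexive 2+k≡fv)
        (D-trans (D-trans (near _ pb) (D-sym near-w′)) (D-sym dpw′))
      -- Three cases: distance `f v + 1` from `v`, one step beyond a boundary vertex; distance
      -- `f v`, on the boundary; and smaller distances, which leave room for the two steps from `v`
      -- to `p`.
      near-p : ∀ {y} → D y v (suc (f v)) → D y p (suc (f v))
      near-p {y} d with D? y v (f v)
      ... | no ¬d = let b , dvb , dby = D-split′ (f v) 1 (≤-reflexive (+-comm 1 (f v))) (D-sym d)
                    in D-trans (D-sym dby)
                         (boundary-near-p (boundary (D-sym dvb) (¬d ∘ extend dby)))
      ... | yes d′ with D? y v (f v ∸ 1)
      ...   | no ¬d = D-mono (n≤1+n (f v)) (boundary-near-p (boundary d′ ¬d))
      ...   | yes d″ = reach (f v ∸ 1) 2 d″ dvp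
        (≤-reflexive (trans (+-comm (f v ∸ 1) 2) (cong suc (m+[n∸m]≡n 0<v))))
      cover : ∀ {z y} → Member v z → D y z (r z) → D y p (suc (ρ (ℓ v)))
      cover {z} mem d with z ≟ v
      ... | yes refl = D-mono (s≤s fv≤ρ) (near-p (D-mono (boost-≤ S v) d))
      ... | no z≢v   = contradiction (z , mem , z≢v) single

    cover-boosted : ∀ {y z c R} e → D z c e → suc (f z) + e ≤ R → D y z (r z) → D y c R
    cover-boosted {z = z} e dzc le d = reach (suc (f z)) e (D-mono (boost-≤ S z) d) dzc le

    cover-plain : ∀ {y z c R} → z ∉ S → ∀ e → D z c e → f z + e ≤ R → D y z (r z) → D y c R
    cover-plain {y} {z} z∉S e dzc le d =
      reach (f z) e (subst (D y z) (boost-∉ S z∉S) d) dzc le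

    -- The new centre is `v`, and radius four is available. An unboosted `x` has radius one and is
    -- within three of `v` via the old centre. A boosted `x` has radius two, but then it must hear
    -- `v`, which puts it within two.
    link-two-one : ∀ {v x w} → v ∈ S → ρ (ℓ v) ≤ 3 → D w v (suc (f v)) → Second v x →
      f v ≡ 2 → f x ≡ 1 → Link v w
    link-two-one {v} {x} {w} v∈S ρ≤3 dw sx@((0<x , x∈) , x≢v) fv≡2 fx≡1 =
      v , D-mono fv+1≤ρ dw , cover
      where
      fv+1≤ρ : suc (f v) ≤ ρ (ℓ v)
      fv+1≤ρ = ≤-trans (≤-reflexive (trans (+-comm 1 (f v)) (cong (f v +_) (≡-sym fx≡1))))
        (mass-≥₂ {ℓ} refl x∈ x≢v)
      3≤ρ : 3 ≤ ρ (ℓ v)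
      3≤ρ = subst (λ a → suc a ≤ ρ (ℓ v)) fv≡2 fv+1≤ρ
      no-third : ¬ ∃ (Third v x)
      no-third (t , tt) = contradiction
        (trans (≡-sym fv≡2) (proj₁ (three-ones (positive v v∈S) ρ≤3 sx tt))) λ ()
      cover : ∀ {z y} → Member v z → D y z (r z) → D y v (suc (ρ (ℓ v)))
      cover {z} mem d with two-members no-third mem
      ... | inj₁ refl = cover-boosted 0 D-refl
        (≤-trans (≤-reflexive (+-identityʳ _)) (≤-trans fv+1≤ρ (n≤1+n _))) d
      ... | inj₂ refl = by-cases (_∈?_ _≟_ x S) d
        where
        by-cases : Dec (x ∈ S) → ∀ {y} → D y x (r x) → D y v (suc (ρ (ℓ v)))
        by-cases (no x∉S) = cover-plain x∉S 3
          (D-trans (centre-near ρ≤3 (0<x , x∈) fx≡1)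
            (D-sym (centre-near ρ≤3 (positive v v∈S , refl) fv≡2)))
          (subst (λ a → a + 3 ≤ suc (ρ (ℓ v))) (≡-sym fx≡1) (s≤s 3≤ρ))
        by-cases (yes x∈S) with neighbour x∈S fx≡1
        ... | z′ , 0<z′ , z′≢x , z′∈ , dxz′ with two-members no-third (0<z′ , trans z′∈ x∈)
        ...   | inj₂ z′≡x = contradiction z′≡x z′≢x
        ...   | inj₁ refl = cover-boosted 2 (D-mono (≤-reflexive fv≡2) dxz′)
          (subst (λ a → suc a + 2 ≤ suc (ρ (ℓ v))) (≡-sym fx≡1) (s≤s 3≤ρ))

    -- The new centre is a vertex within one of both `v` and `x`: it reaches `w` in `2 + 1` and
    -- holds the boosted ball of `x` in `3 + 1`.
    link-one-two : ∀ {v x w} → v ∈ S → ρ (ℓ v) ≤ 3 → D w v (suc (f v)) → Second v x →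
      f v ≡ 1 → f x ≡ 2 → D v x (f x) → Link v w
    link-one-two {v} {x} {w} v∈S ρ≤3 dw sx@((0<x , x∈) , x≢v) fv≡1 fx≡2 dvx =
      let p , dvp , dpx = D-split′ 1 1 (≤-reflexive fx≡2) dvx
      in p , reach 2 1 (D-mono (≤-reflexive (cong suc fv≡1)) dw) dvp 3≤ρ , cover dvp dpx
      where
      3≤ρ : 3 ≤ ρ (ℓ v)
      3≤ρ = ≤-trans (≤-reflexive (≡-sym (cong₂ _+_ fv≡1 fx≡2))) (mass-≥₂ {ℓ} refl x∈ x≢v)
      no-third : ¬ ∃ (Third v x)
      no-third (t , tt) = contradiction
        (trans (≡-sym fx≡2) (proj₁ (proj₂ (three-ones (positive v v∈S) ρ≤3 sx tt)))) λ ()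
      cover : ∀ {p} → D v p 1 → D p x 1 →
        ∀ {z y} → Member v z → D y z (r z) → D y p (suc (ρ (ℓ v)))
      cover dvp dpx {z} mem d with two-members no-third mem
      ... | inj₁ refl = cover-boosted 1 dvp
        (subst (λ a → suc a + 1 ≤ suc (ρ (ℓ v))) (≡-sym fv≡1) (≤-trans 3≤ρ (n≤1+n _))) d
      ... | inj₂ refl = cover-boosted 1 (D-sym dpx)
        (subst (λ a → suc a + 1 ≤ suc (ρ (ℓ v))) (≡-sym fx≡2) (s≤s 3≤ρ)) d

    link-one-one : ∀ {v x w} → v ∈ S → ρ (ℓ v) ≤ 3 → D w v (suc (f v)) → Second v x →
      f v ≡ 1 → f x ≡ 1 → D v x (f x) → ¬ ∃ (Third v x) → Link v w
    link-one-one {v} {x} {w} v∈S ρ≤3 dw ((0<x , x∈) , x≢v) fv≡1 fx≡1 dvx no-third =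
      v , D-mono (≤-trans (≤-reflexive (cong suc fv≡1)) 2≤ρ) dw , cover
      where
      2≤ρ : 2 ≤ ρ (ℓ v)
      2≤ρ = ≤-trans (≤-reflexive (≡-sym (cong₂ _+_ fv≡1 fx≡1))) (mass-≥₂ {ℓ} refl x∈ x≢v)
      cover : ∀ {z y} → Member v z → D y z (r z) → D y v (suc (ρ (ℓ v)))
      cover {z} mem d with two-members no-third mem
      ... | inj₁ refl = cover-boosted 0 D-refl
        (subst (λ a → suc a + 0 ≤ suc (ρ (ℓ v))) (≡-sym fv≡1) (≤-trans 2≤ρ (n≤1+n _))) d
      ... | inj₂ refl = cover-boosted 1 (D-sym (D-mono (≤-reflexive fx≡1) dvx))
        (subst (λ a → suc a + 1 ≤ suc (ρ (ℓ v))) (≡-sym fx≡1) (s≤s 2≤ρ)) d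

    -- All three values are one. A boosted `t` hears `v` or `x`, hence is within two of `v`, and `v`
    -- is the new centre. Otherwise the centre is one step from `v` towards the old one: this brings
    -- `t` within three, enough for its unboosted ball of radius one.
    link-three : ∀ {v x t w} → v ∈ S → ρ (ℓ v) ≤ 3 → D w v (suc (f v)) → Second v x →
      D v x (f x) → Third v x t → Link v w
    link-three {v} {x} {t} {w} v∈S ρ≤3 dw sx@((0<x , x∈) , x≢v) dvx tt@(((0<t , t∈) , t≢v) , t≢x) =
      by-cases (_∈?_ _≟_ t S)
      where
      0<v : 0 < f v
      0<v = positive v v∈S
      fv≡1 : f v ≡ 1
      fv≡1 = proj₁ (three-ones 0<v ρ≤3 sx tt)
      fx≡1 : f x ≡ 1
      fx≡1 = proj₁ (proj₂ (three-ones 0<v ρ≤3 sx tt))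
      ft≡1 : f t ≡ 1
      ft≡1 = proj₂ (proj₂ (three-ones 0<v ρ≤3 sx tt))
      3≤ρ : 3 ≤ ρ (ℓ v)
      3≤ρ = ≤-trans (≤-reflexive (≡-sym (cong₂ _+_ fv≡1 (cong₂ _+_ fx≡1 ft≡1))))
        (mass-≥₃ {ℓ} refl x∈ t∈ x≢v t≢v t≢x)
      dvx₁ : D v x 1
      dvx₁ = D-mono (≤-reflexive fx≡1) dvx
      dw₂ : D w v 2
      dw₂ = D-mono (≤-reflexive (cong suc fv≡1)) dw
      within : ∀ {z y c} e → e ≤ 2 → f z ≡ 1 → D z c e → D y z (r z) → D y c (suc (ρ (ℓ v)))
      within e e≤2 fz≡1 dzc = cover-boosted e dzc
        (subst (λ a → suc a + e ≤ suc (ρ (ℓ v))) (≡-sym fz≡1)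
          (s≤s (≤-trans (s≤s e≤2) 3≤ρ)))
      near-v : t ∈ S → D t v 2
      near-v t∈S with neighbour t∈S ft≡1
      ... | z , 0<z , z≢t , z∈ , dtz with three-members 0<v ρ≤3 sx tt (0<z , trans z∈ t∈)
      ...   | inj₁ refl        = D-mono (≤-trans (≤-reflexive fv≡1) (n≤1+n 1)) dtz
      ...   | inj₂ (inj₁ refl) = D-trans (D-mono (≤-reflexive fx≡1) dtz) (D-sym dvx₁)
      ...   | inj₂ (inj₂ z≡t)  = contradiction z≡t z≢t
      by-cases : Dec (t ∈ S) → Link v w
      by-cases (yes t∈S) = v , D-mono (≤-trans (n≤1+n 2) 3≤ρ) dw₂ , cover
        where
        cover : ∀ {z y} → Member v z → D y z (r z) → D y v (suc (ρ (ℓ v)))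
        cover mem d with three-members 0<v ρ≤3 sx tt mem
        ... | inj₁ refl        = within 0 z≤n fv≡1 D-refl d
        ... | inj₂ (inj₁ refl) = within 1 (s≤s z≤n) fx≡1 (D-sym dvx₁) d
        ... | inj₂ (inj₂ refl) = within 2 ≤-refl ft≡1 (near-v t∈S) d
      by-cases (no t∉S) with D-split 1 (centre-near ρ≤3 (0<v , refl) fv≡1)
      ... | p , dvp , dpm = p , reach 2 1 dw₂ dvp 3≤ρ , cover
        where
        dtp : D t p 3
        dtp = D-trans (centre-near ρ≤3 (0<t , t∈) ft≡1) (D-sym dpm)
        cover : ∀ {z y} → Member v z → D y z (r z) → D y p (suc (ρ (ℓ v)))
        cover mem d with three-members 0<v ρ≤3 sx tt mem
        ... | inj₁ refl        = within 1 (s≤s z≤n) fv≡1 dvp d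
        ... | inj₂ (inj₁ refl) = within 2 ≤-refl fx≡1 (D-trans (D-sym dvx₁) dvp) d
        ... | inj₂ (inj₂ refl) = cover-plain t∉S 3 dtp
          (subst (λ a → a + 3 ≤ suc (ρ (ℓ v))) (≡-sym ft≡1) (s≤s 3≤ρ)) d

    -- If a second member exists and `f v ≥ 2`, the values are two and one. If `f v = 1`, the second
    -- member is chosen by `neighbour`, so that `v` hears it.
    link : ∀ {v w} → v ∈ S → ρ (ℓ v) ≤ 3 → D w v (suc (f v)) → ¬ D w v (f v) → Link v w
    link {v} {w} v∈S ρ≤3 dw ¬dw with any? (second? v)
    ... | no single = link-single v∈S ρ≤3 dw ¬dw single
    ... | yes (x , sx@((0<x , x∈) , x≢v)) with 2 ≤? f v
    ...   | yes 2≤fv = link-two-one v∈S ρ≤3 dw sx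
      (≤-antisym (+-cancelʳ-≤ 1 (f v) 2 (≤-trans (+-monoʳ-≤ (f v) 0<x) total≤3)) 2≤fv)
      (≤-antisym (+-cancelˡ-≤ 2 (f x) 1 (≤-trans (+-monoˡ-≤ (f x) 2≤fv) total≤3)) 0<x)
      where
      total≤3 : f v + f x ≤ 3
      total≤3 = ≤-trans (mass-≥₂ {ℓ} refl x∈ x≢v) ρ≤3
    ...   | no 2≰fv = by-neighbour (neighbour v∈S fv≡1)
      where
      fv≡1 : f v ≡ 1
      fv≡1 = ≤-antisym (≤-pred (≰⇒> 2≰fv)) (positive v v∈S)
      by-neighbour : ∃[ z ] (0 < f z × z ≢ v × ℓ z ≡ ℓ v × D v z (f z)) → Link v w
      by-neighbour (z , 0<z , z≢v , z∈ , dvz) with any? (third? v z)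
      ... | yes (t , tt) = link-three v∈S ρ≤3 dw ((0<z , z∈) , z≢v) dvz tt
      ... | no no-third with 2 ≤? f z
      ...   | yes 2≤fz = link-one-two v∈S ρ≤3 dw ((0<z , z∈) , z≢v) fv≡1 (≤-antisym fz≤2 2≤fz) dvz
        where
        fz≤2 : f z ≤ 2
        fz≤2 = +-cancelˡ-≤ 1 (f z) 2
          (≤-trans (subst (λ a → a + f z ≤ ρ (ℓ v)) fv≡1 (mass-≥₂ {ℓ} refl z∈ z≢v)) ρ≤3)
      ...   | no 2≰fz = link-one-one v∈S ρ≤3 dw ((0<z , z∈) , z≢v) fv≡1
        (≤-antisym (≤-pred (≰⇒> 2≰fz)) 0<z) dvz no-third

    -- Covers of cost at most 5/4 of the mass

    -- Vertices of Ω may be left out around an unboosted v, since every boosted ball is dominated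
    -- in full by the cover of its own cluster.
    OK : (Fin n → Set) → ℕ → Set
    OK P w = ∃[ g ] (4 * sum g ≤ 5 * w ×
      (∀ {v y} → P v → 0 < f v → D y v (r v) → (v ∉ S → ¬ Ω y) → Dominated G g y))

    OK-resp : ∀ {P P′ w w′} → (∀ {v} → P′ v → P v) → w ≤ w′ → OK P w → OK P′ w′
    OK-resp P′⇒P w≤w′ (g , cost , cover) =
      g , ≤-trans cost (*-monoʳ-≤ 5 w≤w′) , λ Pv → cover (P′⇒P Pv)

    cheap : ∀ {a w} → a ≤ w → 4 * a ≤ 5 * w
    cheap {a} {w} a≤w = *-mono-≤ (n≤1+n 4) a≤w

    -- An unboosted x whose private boundary is reached by boosted balls can lose one unit of
    -- radius, which pays for the boost of v.
    reduce : ∀ {v x} → v ∈ S → ρ (ℓ v) ≤ 3 → Second v x → x ∉ S →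
      (∀ {y} → InPB G f x y → Ω y) → OK (λ u → ℓ u ≡ ℓ v) (ρ (ℓ v))
    reduce {v} {x} v∈S ρ≤3 sx@((0<x , x∈) , x≢v) x∉S pb⊆Ω = by-third (any? (third? v x))
      where
      0<v : 0 < f v
      0<v = positive v v∈S
      Cover : (Fin n → ℕ) → Set
      Cover g = ∀ {z y} → ℓ z ≡ ℓ v → 0 < f z → D y z (r z) → (z ∉ S → ¬ Ω y) → Dominated G g y
      -- Outside `Ω` no vertex of the ball of `x` is private, so each is still dominated after `x`
      -- is lowered.
      rest : ∀ {y} → D y x (r x) → (x ∉ S → ¬ Ω y) →
        (0 < f x ∸ 1 × D y x (f x ∸ 1)) ⊎ ∃[ z ] (0 < f z × z ≢ x × ℓ z ≡ ℓ x × D y z (f z))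
      rest {y} d ¬Ω = dominated-decAt 0<x d′ (¬InPB⇒dominated d′ λ pb → ¬Ω x∉S (pb⊆Ω pb))
        where
        d′ : D y x (f x)
        d′ = subst (D y x) (boost-∉ S x∉S) d
      boosted : Fin n → ℕ
      boosted = ball v (suc (f v))
      reduced : Fin n → ℕ
      reduced = ball x (f x ∸ 1)
      pair : Fin n → ℕ
      pair = boosted ⊕ reduced
      in-boosted : ∀ {k y} → k ≤ suc (f v) → D y v k → Dominated G boosted y
      in-boosted k≤ d = dominated-ball (s≤s z≤n) (D-mono k≤ d)
      pair-cost : sum pair ≡ f v + f x
      pair-cost = begin
        sum pair                  ≡⟨ sum-⊕ boosted reduced ⟩
        sum boosted + sum reduced ≡⟨ cong₂ _+_ (sum-δ v _) (sum-δ x _) ⟩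
        suc (f v) + (f x ∸ 1)     ≡⟨ +-suc (f v) (f x ∸ 1) ⟨
        f v + (1 + (f x ∸ 1))     ≡⟨ cong (f v +_) (m+[n∸m]≡n 0<x) ⟩
        f v + f x                 ∎
        where open ≡-Reasoning
      by-third : Dec (∃ (Third v x)) → OK (λ u → ℓ u ≡ ℓ v) (ρ (ℓ v))
      by-third (no none) =
        pair , cheap (≤-trans (≤-reflexive pair-cost) (mass-≥₂ {ℓ} refl x∈ x≢v)) , cover
        where
        cover : Cover pair
        cover z∈ 0<z d ¬Ω with two-members none (0<z , z∈)
        ... | inj₁ refl = dominated-⊕ˡ (in-boosted (boost-≤ S v) d)
        ... | inj₂ refl with rest d ¬Ω
        ...   | inj₁ (pos , d′) = dominated-⊕ʳ {boosted} (dominated-ball pos d′)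
        ...   | inj₂ (z , 0<z′ , z≢x , z∈x , d′) with two-members none (0<z′ , trans z∈x x∈)
        ...     | inj₁ refl = dominated-⊕ˡ (in-boosted (n≤1+n (f v)) d′)
        ...     | inj₂ z≡x  = contradiction z≡x z≢x
      by-third (yes (t , tt@(((0<t , t∈) , t≢v) , t≢x))) = by-cases (_∈?_ _≟_ t S)
        where
        members : ∀ {z} → Member v z → z ≡ v ⊎ z ≡ x ⊎ z ≡ t
        members = three-members 0<v ρ≤3 sx tt
        fv≡1 : f v ≡ 1
        fv≡1 = proj₁ (three-ones 0<v ρ≤3 sx tt)
        fx≡1 : f x ≡ 1
        fx≡1 = proj₁ (proj₂ (three-ones 0<v ρ≤3 sx tt))
        ft≡1 : f t ≡ 1
        ft≡1 = proj₂ (proj₂ (three-ones 0<v ρ≤3 sx tt))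
        3≤ρ : 3 ≤ ρ (ℓ v)
        3≤ρ = ≤-trans (≤-reflexive (≡-sym (cong₂ _+_ fv≡1 (cong₂ _+_ fx≡1 ft≡1))))
          (mass-≥₃ {ℓ} refl x∈ t∈ x≢v t≢v t≢x)
        -- Radius `2 + 1` about `c` holds the boosted balls of `v` and `t`, at the price of the
        -- three unit balls. What is left of the ball of `x` outside `Ω` lies in those of `v` and
        -- `t`.
        hub-ok : ∃[ c ] (D v c 1 × D t c 1) → OK (λ u → ℓ u ≡ ℓ v) (ρ (ℓ v))
        hub-ok (c , dvc , dtc) = ball c 3
          , cheap (≤-trans (≤-reflexive (sum-δ c 3)) 3≤ρ) , cover
          where
          inside : ∀ {z y k} → D z c 1 → f z ≡ 1 → k ≤ suc (f z) → D y z k → Dominated G (ball c 3) y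
          inside dzc fz≡1 k≤ d = dominated-ball (s≤s z≤n)
            (D-trans (D-mono (≤-trans k≤ (≤-reflexive (cong suc fz≡1))) d) dzc)
          cover : Cover (ball c 3)
          cover z∈ 0<z d ¬Ω with members (0<z , z∈)
          ... | inj₁ refl        = inside dvc fv≡1 (boost-≤ S v) d
          ... | inj₂ (inj₂ refl) = inside dtc ft≡1 (boost-≤ S t) d
          ... | inj₂ (inj₁ refl) with rest d ¬Ω
          ...   | inj₁ (pos , _) = contradiction (subst (λ a → 0 < a ∸ 1) fx≡1 pos) λ ()
          ...   | inj₂ (z , 0<z′ , z≢x , z∈x , d′) with members (0<z′ , trans z∈x x∈)
          ...     | inj₁ refl        = inside dvc fv≡1 (n≤1+n (f v)) d′
          ...     | inj₂ (inj₁ z≡x)  = contradiction z≡x z≢x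
          ...     | inj₂ (inj₂ refl) = inside dtc ft≡1 (n≤1+n (f t)) d′
        -- Each of `v` and `t` hears another member. If one hears the other, the one heard serves as
        -- `c`; otherwise both hear `x`.
        common : t ∈ S → ∃[ c ] (D v c 1 × D t c 1)
        common t∈S with neighbour v∈S fv≡1 | neighbour t∈S ft≡1
        ... | a , 0<a , a≢v , a∈ , dva | b , 0<b , b≢t , b∈ , dtb
            with members (0<a , a∈) | members (0<b , trans b∈ t∈)
        ...   | inj₁ a≡v         | _                = contradiction a≡v a≢v
        ...   | _                | inj₂ (inj₂ b≡t)  = contradiction b≡t b≢t
        ...   | inj₂ (inj₂ refl) | _                = t , D-mono (≤-reflexive ft≡1) dva , D-refl
        ...   | _                | inj₁ refl        = v , D-refl , D-mono (≤-reflexive fv≡1) dtb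
        ...   | inj₂ (inj₁ refl) | inj₂ (inj₁ refl) =
          x , D-mono (≤-reflexive fx≡1) dva , D-mono (≤-reflexive fx≡1) dtb
        by-cases : Dec (t ∈ S) → OK (λ u → ℓ u ≡ ℓ v) (ρ (ℓ v))
        by-cases (yes t∈S) = hub-ok (common t∈S)
        by-cases (no t∉S)  = triple , cheap (≤-trans (≤-reflexive triple-cost)
          (mass-≥₃ {ℓ} refl x∈ t∈ x≢v t≢v t≢x)) , cover
          where
          kept : Fin n → ℕ
          kept = ball t (f t)
          triple : Fin n → ℕ
          triple = pair ⊕ kept
          triple-cost : sum triple ≡ f v + (f x + f t)
          triple-cost = trans (sum-⊕ pair kept)
            (trans (cong₂ _+_ pair-cost (sum-δ t (f t))) (+-assoc (f v) (f x) (f t)))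
          cover : Cover triple
          cover z∈ 0<z d ¬Ω with members (0<z , z∈)
          ... | inj₁ refl        = dominated-⊕ˡ {pair} (dominated-⊕ˡ (in-boosted (boost-≤ S v) d))
          ... | inj₂ (inj₂ refl) = dominated-⊕ʳ {pair}
            (dominated-ball 0<t (subst (D _ t) (boost-∉ S t∉S) d))
          ... | inj₂ (inj₁ refl) with rest d ¬Ω
          ...   | inj₁ (pos , d′) =
            dominated-⊕ˡ {pair} (dominated-⊕ʳ {boosted} (dominated-ball pos d′))
          ...   | inj₂ (z , 0<z′ , z≢x , z∈x , d′) with members (0<z′ , trans z∈x x∈)
          ...     | inj₁ refl        = dominated-⊕ˡ {pair} (dominated-⊕ˡ (in-boosted (n≤1+n (f v)) d′))
          ...     | inj₂ (inj₁ z≡x)  = contradiction z≡x z≢x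
          ...     | inj₂ (inj₂ refl) = dominated-⊕ʳ {pair} (dominated-ball 0<t d′)

    -- The clusters in R have been treated: π sends each cluster that was merged to the cluster it
    -- was attached to and fixes all others.
    record Plan (R : List (Fin n)) : Set where
      field
        π   : Fin n → Fin n
        hub : Fin n → Fin n
      W : Fin n → ℕ
      W = mass (π ∘ ℓ)
      field
        leaf  : ∀ {i} → π i ≢ i → i ∈ R
        idem  : ∀ i → π (π i) ≡ π i
        -- Only for clusters fixed by `π`: a recentred leaf is known to fit only after the extra
        -- unit of `outer`. This suffices, as clusters are attached only to clusters outside `R`,
        -- which are fixed.
        inner : ∀ {v y} → π (ℓ v) ≡ ℓ v → 0 < f v → D y v (f v) → D y (hub (ℓ v)) (W (ℓ v))
        outer : ∀ {v y} → 0 < f v → D y v (r v) → D y (hub (π (ℓ v))) (suc (W (π (ℓ v))))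
        ok    : ∀ {i} → i ∈ R → OK (λ v → π (ℓ v) ≡ π i) (W (π i))

      root : ∀ {i} → i ∉ R → π i ≡ i
      root {i} i∉R = decidable-stable (π i ≟ i) (i∉R ∘ leaf)

      merged? : ∀ j → Dec (∃[ i ] (i ≢ j × π i ≡ j))
      merged? j = any? λ i → ¬? (i ≟ j) ×-dec (π i ≟ j)

      merged-ok : ∀ {j} → ∃[ i ] (i ≢ j × π i ≡ j) → OK (λ v → π (ℓ v) ≡ j) (W j)
      merged-ok (i , i≢j , refl) = ok (leaf (i≢j ∘ ≡-sym))

      mass≤W : ∀ {j} → π j ≡ j → ρ j ≤ W j
      mass≤W πj≡j = mass-mono {ℓ} {π ∘ ℓ} λ v eq → trans (cong π eq) πj≡j

      only : ∀ {j} → ¬ (∃[ i ] (i ≢ j × π i ≡ j)) → ∀ {i} → π i ≡ j → i ≡ j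
      only {j} unmerged {i} eq = decidable-stable (i ≟ j) λ i≢j → unmerged (i , i≢j , eq)

    -- Construction of plans, one light cluster at a time

    base-outer : ∀ {v y} → 0 < f v → D y v (r v) → D y (centre (ℓ v)) (suc (ρ (ℓ v)))
    base-outer {v} 0<v d =
      let e , dve , le = centred v 0<v
      in cover-boosted e dve (s≤s le) d

    plan-[] : Plan []
    plan-[] = record
      { π     = id
      ; hub   = centre
      ; leaf  = λ ¬refl → contradiction refl ¬refl
      ; idem  = λ _ → refl
      ; inner = λ {v} _ 0<v d → let e , dve , le = centred v 0<v in reach (f v) e d dve le
      ; outer = base-outer
      ; ok    = λ ()
      }

    -- If clusters were already attached to that of `v`, their star is within budget. Otherwise the
    -- class is this cluster alone and `reduce` applies.
    plan-reduce : ∀ {R v x} → v ∈ S → ρ (ℓ v) ≤ 3 → Second v x → x ∉ S →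
      (∀ {y} → InPB G f x y → Ω y) → Plan (without (ℓ v) R) → Plan R
    plan-reduce {R} {v} v∈S ρ≤3 sx x∉S pb⊆Ω P = record
      { π     = π
      ; hub   = hub
      ; leaf  = λ ≢i → proj₁ (∈-without⁻ {xs = R} (leaf ≢i))
      ; idem  = idem
      ; inner = inner
      ; outer = outer
      ; ok    = λ {i} i∈R → ok′ i∈R (i ≟ ℓ v)
      }
      where
      open Plan P
      j : Fin n
      j = ℓ v
      πj≡j : π j ≡ j
      πj≡j = root λ j∈ → proj₂ (∈-without⁻ {xs = R} j∈) refl
      j-ok : Dec (∃[ i ] (i ≢ j × π i ≡ j)) → OK (λ u → π (ℓ u) ≡ j) (W j)
      j-ok (yes m) = merged-ok m
      j-ok (no unmerged) =
        OK-resp (only unmerged) (mass≤W πj≡j) (reduce v∈S ρ≤3 sx x∉S pb⊆Ω)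
      ok′ : ∀ {i} → i ∈ R → Dec (i ≡ ℓ v) → OK (λ u → π (ℓ u) ≡ π i) (W (π i))
      ok′ i∈R (no i≢j)   = ok (∈-without⁺ i∈R i≢j)
      ok′ i∈R (yes refl) = subst (λ c → OK (λ u → π (ℓ u) ≡ c) (W c)) (≡-sym πj≡j) (j-ok (merged? j))

    module Attach {R : List (Fin n)} {v x w : Fin n} (v∈S : v ∈ S) (ρ≤3 : ρ (ℓ v) ≤ 3)
      (i∈R : ℓ v ∈ R) (0<x : 0 < f x) (j∉R : ℓ x ∉ R) (pb⊆Ω : ∀ {y} → InPB G f x y → Ω y)
      (dwx : D w x (f x)) (dwv : D w v (suc (f v))) (P : Plan (without (ℓ v) R)) where

      open Plan P

      i j : Fin n
      i = ℓ v
      j = ℓ x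

      i≢j : i ≢ j
      i≢j i≡j = j∉R (subst (_∈ R) i≡j i∈R)

      πi≡i : π i ≡ i
      πi≡i = root λ i∈ → proj₂ (∈-without⁻ {xs = R} i∈) refl

      πj≡j : π j ≡ j
      πj≡j = root λ j∈ → j∉R (proj₁ (∈-without⁻ {xs = R} j∈))

      linked : Link v w
      linked = link v∈S ρ≤3 dwv λ d → i≢j (overlapping (positive v v∈S) 0<x d dwx)

      c : Fin n
      c = proj₁ linked

      -- The route runs through `w`, within `ρ i` of `c` and, `j` being fixed by `π`, within `W j`
      -- of its hub.
      met : ∃[ m ] (D c m (W j) × D (hub j) m (ρ i))
      met = merge (ρ i) (W j) (D-trans (D-sym (proj₁ (proj₂ linked))) (inner πj≡j 0<x dwx))

      m : Fin n
      m = proj₁ met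

      π′ hub′ : Fin n → Fin n
      π′ = relabel i j ∘ π
      hub′ a = if does (a ≟ j) then m else hub a

      hub′-j : hub′ j ≡ m
      hub′-j with j ≟ j
      ... | yes _  = refl
      ... | no j≢j = contradiction refl j≢j

      hub′-≢ : ∀ {a} → a ≢ j → hub′ a ≡ hub a
      hub′-≢ {a} a≢j with a ≟ j
      ... | yes a≡j = contradiction a≡j a≢j
      ... | no _    = refl

      W′ : Fin n → ℕ
      W′ = mass (π′ ∘ ℓ)

      W+W≡W′ : W i + W j ≡ W′ j
      W+W≡W′ = mass-relabel {π ∘ ℓ} i≢j

      ρ+W≤W′ : ρ i + W j ≤ W′ j
      ρ+W≤W′ = ≤-trans (+-monoˡ-≤ (W j) (mass≤W πi≡i)) (≤-reflexive W+W≡W′)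

      π′-i : ∀ {a} → π a ≡ i → π′ a ≡ j
      π′-i eq = trans (cong (relabel i j) eq) (relabel-≡ i j)

      π′-≢ : ∀ {a} → π a ≢ i → π′ a ≡ π a
      π′-≢ = relabel-≢

      π′-j : π′ j ≡ j
      π′-j = trans (π′-≢ λ eq → i≢j (trans (≡-sym eq) πj≡j)) πj≡j

      W≤W′ : ∀ {a} → a ≢ i → W a ≤ W′ a
      W≤W′ a≢i = mass-mono {π ∘ ℓ} {π′ ∘ ℓ} λ u eq →
        trans (π′-≢ λ πu≡i → a≢i (trans (≡-sym eq) πu≡i)) eq

      to-j : ∀ {y k} a → a ≡ j → D y m k → k ≤ W′ j → D y (hub′ a) (W′ a)
      to-j .j refl d k≤ = subst (λ h → D _ h (W′ j)) (≡-sym hub′-j) (D-mono k≤ d)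

      to-j⁺ : ∀ {y k} a → a ≡ j → D y m k → k ≤ suc (W′ j) → D y (hub′ a) (suc (W′ a))
      to-j⁺ .j refl d k≤ = subst (λ h → D _ h (suc (W′ j))) (≡-sym hub′-j) (D-mono k≤ d)

      module Unmerged (unmerged : ¬ (∃[ a ] (a ≢ i × π a ≡ i))) where

        inner′ : ∀ {u y} → π′ (ℓ u) ≡ ℓ u → 0 < f u → D y u (f u) → D y (hub′ (ℓ u)) (W′ (ℓ u))
        inner′ {u} {y} fixed 0<u d = by-cases (π (ℓ u) ≟ i) (ℓ u ≟ j)
          where
          by-cases : Dec (π (ℓ u) ≡ i) → Dec (ℓ u ≡ j) → D y (hub′ (ℓ u)) (W′ (ℓ u))
          by-cases (yes πu≡i) _ = contradiction
            (trans (≡-sym (only unmerged πu≡i)) (trans (≡-sym fixed) (π′-i πu≡i))) i≢j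
          by-cases (no πu≢i) (yes eq) = to-j (ℓ u) eq
            (D-trans (subst (λ a → D y (hub a) (W a)) eq (inner (trans (≡-sym (π′-≢ πu≢i)) fixed) 0<u d))
              (proj₂ (proj₂ met)))
            (≤-trans (≤-reflexive (+-comm (W j) (ρ i))) ρ+W≤W′)
          by-cases (no πu≢i) (no ≢j) = subst (λ h → D y h (W′ (ℓ u))) (≡-sym (hub′-≢ ≢j))
            (D-mono (W≤W′ λ eq → πu≢i (trans (cong π eq) πi≡i))
              (inner (trans (≡-sym (π′-≢ πu≢i)) fixed) 0<u d))

        -- Members of `i` need `(ρ i + 1) + W j`, members of the star at `j` need `(W j + 1) + ρ i`:
        -- the two extra units are not added, so one unit serves the enlarged star.
        outer′ : ∀ {u y} → 0 < f u → D y u (r u) → D y (hub′ (π′ (ℓ u))) (suc (W′ (π′ (ℓ u))))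
        outer′ {u} {y} 0<u d = by-cases (π (ℓ u) ≟ i) (π (ℓ u) ≟ j)
          where
          by-cases : Dec (π (ℓ u) ≡ i) → Dec (π (ℓ u) ≡ j) →
            D y (hub′ (π′ (ℓ u))) (suc (W′ (π′ (ℓ u))))
          by-cases (yes πu≡i) _ = to-j⁺ _ (π′-i πu≡i)
            (D-trans (proj₂ (proj₂ linked) (0<u , only unmerged πu≡i) d) (proj₁ (proj₂ met)))
            (s≤s ρ+W≤W′)
          by-cases (no πu≢i) (yes πu≡j) = to-j⁺ _ (trans (π′-≢ πu≢i) πu≡j)
            (D-trans (subst (λ a → D y (hub a) (suc (W a))) πu≡j (outer 0<u d)) (proj₂ (proj₂ met)))
            (s≤s (≤-trans (≤-reflexive (+-comm (W j) (ρ i))) ρ+W≤W′))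
          by-cases (no πu≢i) (no πu≢j) =
            subst (λ a → D y (hub′ a) (suc (W′ a))) (≡-sym (π′-≢ πu≢i))
              (subst (λ h → D y h (suc (W′ (π (ℓ u))))) (≡-sym (hub′-≢ πu≢j))
                (D-mono (s≤s (W≤W′ πu≢i)) (outer 0<u d)))

        class-j : ∀ {u} → π′ (ℓ u) ≡ j → ℓ u ≡ i ⊎ π (ℓ u) ≡ j
        class-j {u} eq with π (ℓ u) ≟ i
        ... | yes πu≡i = inj₁ (only unmerged πu≡i)
        ... | no _     = inj₂ eq

        -- Here the cluster i has mass two and x is alone with f x = 1, so all of N[x] is private
        -- and x can be dropped.
        small-ok : ¬ (4 ≤ W′ j) → OK (λ u → π′ (ℓ u) ≡ j) (W′ j)
        small-ok W′≱4 = ball (centre i) (suc (ρ i)) , cost , cover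
          where
          2≤ρ : 2 ≤ ρ i
          2≤ρ = mass-≥2 v∈S
          1≤W : 1 ≤ W j
          1≤W = ≤-trans 0<x (mass-≥₁ {π ∘ ℓ} πj≡j)
          ρ+W≤3 : ρ i + W j ≤ 3
          ρ+W≤3 = ≤-trans ρ+W≤W′ (≤-pred (≰⇒> W′≱4))
          ρ≤2 : ρ i ≤ 2
          ρ≤2 = +-cancelʳ-≤ 1 (ρ i) 2 (≤-trans (+-monoʳ-≤ (ρ i) 1≤W) ρ+W≤3)
          W≤1 : W j ≤ 1
          W≤1 = +-cancelˡ-≤ 2 (W j) 1 (≤-trans (+-monoˡ-≤ (W j) 2≤ρ) ρ+W≤3)
          -- The ball has radius at most three and the joint mass is at least three, so `12 ≤ 15` is
          -- enough.
          cost : 4 * sum (ball (centre i) (suc (ρ i))) ≤ 5 * W′ j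
          cost = ≤-trans (*-monoʳ-≤ 4 (≤-trans (≤-reflexive (sum-δ (centre i) _)) (s≤s ρ≤2)))
            (≤-trans (m≤m+n 12 3)
              (*-monoʳ-≤ 5 (≤-trans (+-mono-≤ 2≤ρ 1≤W) ρ+W≤W′)))
          alone : ∀ {u} → 0 < f u → π (ℓ u) ≡ j → u ≡ x
          alone {u} 0<u u∈ = decidable-stable (u ≟ x) λ u≢x → contradiction
            (≤-trans (≤-trans (+-mono-≤ 0<x 0<u) (mass-≥₂ {π ∘ ℓ} πj≡j u∈ u≢x)) W≤1)
            λ { (s≤s ()) }
          x∉S : x ∉ S
          x∉S x∈S = contradiction (≤-trans (≤-trans (mass-≥2 x∈S) (mass≤W πj≡j)) W≤1) λ { (s≤s ()) }
          fx≤1 : f x ≤ 1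
          fx≤1 = ≤-trans (mass-≥₁ {π ∘ ℓ} πj≡j) W≤1
          private-x : ∀ {y} → D y x (f x) → InPB G f x y
          private-x {y} d = decidable-stable (inPB? f x y) λ ¬pb → impossible
            (dominated-decAt 0<x d (¬InPB⇒dominated d ¬pb))
            where
            impossible : ¬ ((0 < f x ∸ 1 × D y x (f x ∸ 1))
                            ⊎ ∃[ z ] (0 < f z × z ≢ x × ℓ z ≡ ℓ x × D y z (f z)))
            impossible (inj₁ (pos , _)) = contradiction (≤-trans pos (∸-monoˡ-≤ 1 fx≤1)) λ ()
            impossible (inj₂ (z , 0<z , z≢x , z∈ , _)) = z≢x (alone 0<z (trans (cong π z∈) πj≡j))
          cover : ∀ {u y} → π′ (ℓ u) ≡ j → 0 < f u → D y u (r u) → (u ∉ S → ¬ Ω y) →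
            Dominated G (ball (centre i) (suc (ρ i))) y
          cover {u} {y} u∈ 0<u d ¬Ω with class-j u∈
          ... | inj₁ eq = dominated-ball (s≤s z≤n)
            (subst (λ a → D y (centre a) (suc (ρ a))) eq (base-outer 0<u d))
          ... | inj₂ eq with alone 0<u eq
          ...   | refl = contradiction
            (pb⊆Ω (private-x (subst (D y x) (boost-∉ S x∉S) d))) (¬Ω x∉S)

        -- The inequality `4 * (W + 1) ≤ 5 * W` is the same as `4 ≤ W`.
        large-ok : 4 ≤ W′ j → OK (λ u → π′ (ℓ u) ≡ j) (W′ j)
        large-ok 4≤W′ = ball (hub′ j) (suc (W′ j))
          , ≤-trans (≤-reflexive (trans (cong (4 *_) (sum-δ (hub′ j) _)) (*-suc 4 (W′ j))))
              (+-monoˡ-≤ (4 * W′ j) 4≤W′)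
          , λ {u} {y} u∈ 0<u d _ → dominated-ball (s≤s z≤n)
              (subst (λ a → D y (hub′ a) (suc (W′ a))) u∈ (outer′ 0<u d))

        j-ok : OK (λ u → π′ (ℓ u) ≡ j) (W′ j)
        j-ok with 4 ≤? W′ j
        ... | yes 4≤W′ = large-ok 4≤W′
        ... | no W′≱4  = small-ok W′≱4

        idem′ : ∀ a → π′ (π′ a) ≡ π′ a
        idem′ a = by-cases (π a ≟ i)
          where
          by-cases : Dec (π a ≡ i) → π′ (π′ a) ≡ π′ a
          by-cases (yes eq) = trans (cong π′ (π′-i eq)) (trans π′-j (≡-sym (π′-i eq)))
          by-cases (no neq) = trans (cong π′ (π′-≢ neq)) (cong (relabel i j) (idem a))

        leaf′ : ∀ {a} → π′ a ≢ a → a ∈ R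
        leaf′ {a} moved with a ≟ i
        ... | yes refl = i∈R
        ... | no a≢i   = proj₁ (∈-without⁻ {xs = R} (leaf λ fixed →
          moved (trans (π′-≢ λ eq → a≢i (trans (≡-sym fixed) eq)) fixed)))

        ok′ : ∀ {a} → a ∈ R → OK (λ u → π′ (ℓ u) ≡ π′ a) (W′ (π′ a))
        ok′ {a} a∈R = by-cases (π′ a ≟ j)
          where
          by-cases : Dec (π′ a ≡ j) → OK (λ u → π′ (ℓ u) ≡ π′ a) (W′ (π′ a))
          by-cases (yes eq) = subst (λ b → OK (λ u → π′ (ℓ u) ≡ b) (W′ b)) (≡-sym eq) j-ok
          by-cases (no neq) = subst (λ b → OK (λ u → π′ (ℓ u) ≡ b) (W′ b)) (≡-sym (π′-≢ πa≢i))
            (OK-resp same (W≤W′ πa≢i) (ok (∈-without⁺ a∈R a≢i)))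
            where
            πa≢i : π a ≢ i
            πa≢i eq = neq (π′-i eq)
            a≢i : a ≢ i
            a≢i refl = πa≢i πi≡i
            same : ∀ {u} → π′ (ℓ u) ≡ π a → π (ℓ u) ≡ π a
            same {u} eq with π (ℓ u) ≟ i
            ... | yes _ = contradiction (trans (π′-≢ πa≢i) (≡-sym eq)) neq
            ... | no _  = eq

        attached : Plan R
        attached = record
          { π = π′ ; hub = hub′ ; leaf = leaf′ ; idem = idem′
          ; inner = inner′ ; outer = outer′ ; ok = ok′ }

      -- If `i` already carries leaves, its star is within budget and the plan stands. Otherwise
      -- attaching `i` to the fixed cluster `j` keeps all stars of depth one.
      attach : Plan R
      attach with merged? i
      ... | no unmerged = Unmerged.attached unmerged
      ... | yes mi      = record
        { π     = π
        ; hub   = hub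
        ; leaf  = λ ≢a → proj₁ (∈-without⁻ {xs = R} (leaf ≢a))
        ; idem  = idem
        ; inner = inner
        ; outer = outer
        ; ok    = ok′
        }
        where
        ok′ : ∀ {a} → a ∈ R → OK (λ u → π (ℓ u) ≡ π a) (W (π a))
        ok′ {a} a∈R with a ≟ i
        ... | no a≢i   = ok (∈-without⁺ a∈R a≢i)
        ... | yes refl =
          subst (λ b → OK (λ u → π (ℓ u) ≡ b) (W b)) (≡-sym πi≡i) (merged-ok mi)

    Bad : Fin n → Set
    Bad i = ρ i ≤ 3 × ∃[ v ] (v ∈ S × ℓ v ≡ i)

    -- Each step removes one cluster from `R`. Boosting exactly the vertices of `S` in clusters of
    -- `R` breaks irredundance at some `x`. If the cluster of `x` is in `R`, it is treated by
    -- `plan-reduce`; otherwise some cluster of `R` meets it and is treated by `Attach`.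
    plan : ∀ k R → length R ≤ k → (∀ {i} → i ∈ R → Bad i) → Plan R
    plan k       []          _   _   = plan-[]
    plan (suc k) R@(i₀ ∷ R₀) len bad = step kill
      where
      in-R? : Decidable (λ v → ℓ v ∈ R)
      in-R? v = _∈?_ _≟_ (ℓ v) R
      T : List (Fin n)
      T = filter in-R? S
      T⊆S : ∀ {v} → v ∈ T → v ∈ S
      T⊆S v∈T = proj₁ (∈-filter⁻ in-R? {xs = S} v∈T)
      T⊆R : ∀ {v} → v ∈ T → ℓ v ∈ R
      T⊆R v∈T = proj₂ (∈-filter⁻ in-R? {xs = S} v∈T)
      kill : ∃[ x ] (0 < f x × x ∉ T × (∀ y → InPB G f x y → ∃[ v ] (v ∈ T × D y v (suc (f v)))))
      kill = boost-kills T nonempty far priv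
        where
        nonempty : ∃[ v ] v ∈ T
        nonempty with bad (here refl)
        ... | _ , v , v∈S , eq = v , ∈-filter⁺ in-R? v∈S (here eq)
        far : ∀ v → v ∈ T → ∃[ p ] (¬ D p v (f v) × D p v (suc (f v)))
        far v v∈T =
          let u , ¬dom , d , _ = minimal v (T⊆S v∈T)
          in u , undominated-far ¬dom (positive v (T⊆S v∈T)) , d
        priv : ∀ v → v ∈ T → PrivatelyReaches T v
        priv v v∈T =
          let u , ¬dom , d , p = minimal v (T⊆S v∈T)
          in u , ¬dom , d , λ v′ v′∈T → p v′ (T⊆S v′∈T)
      smaller : ∀ {i} → i ∈ R → Plan (without i R)
      smaller {i} i∈R = plan k (without i R)
        (≤-pred (≤-trans (length-without R i∈R) len))
        (λ a∈ → bad (proj₁ (∈-without⁻ {xs = R} a∈)))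
      step : ∃[ x ] (0 < f x × x ∉ T × (∀ y → InPB G f x y → ∃[ v ] (v ∈ T × D y v (suc (f v))))) →
        Plan R
      step (x , 0<x , x∉T , killed) = by-cases (in-R? x)
        where
        pb⊆Ω : ∀ {y} → InPB G f x y → Ω y
        pb⊆Ω {y} pb = let v , v∈T , d = killed y pb in v , T⊆S v∈T , d
        by-cases : Dec (ℓ x ∈ R) → Plan R
        by-cases (yes j∈R) =
          let ρ≤3 , v , v∈S , eq = bad j∈R
              -- A boosted vertex in a cluster of `R` would belong to `T`.
              x∉S = λ x∈S → x∉T (∈-filter⁺ in-R? x∈S j∈R)
          in plan-reduce v∈S (subst (λ a → ρ a ≤ 3) (≡-sym eq) ρ≤3)
               ((0<x , ≡-sym eq) , λ x≡v → x∉S (subst (_∈ S) (≡-sym x≡v) v∈S))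
               x∉S pb⊆Ω (smaller (subst (_∈ R) (≡-sym eq) j∈R))
        by-cases (no j∉R) =
          let w , pb = proj₁ (proj₂ maximal) x 0<x
              v , v∈T , d = killed w pb
              i∈R = T⊆R v∈T
          in Attach.attach (T⊆S v∈T) (proj₁ (bad i∈R)) i∈R 0<x j∉R pb⊆Ω (proj₁ pb) d (smaller i∈R)

    -- Assembly of the covers of all classes

    dominating-within : ∃[ g ] (4 * sum g ≤ 5 * sum f × (∀ u → Dominated G g u))
    dominating-within = total , cost , dominated
      where
      light? : Decidable (λ v → ρ (ℓ v) ≤ 3)
      light? v = ρ (ℓ v) ≤? 3
      R : List (Fin n)
      R = map ℓ (filter light? S)
      bad : ∀ {i} → i ∈ R → Bad i
      bad i∈R with ∈-map⁻ ℓ i∈R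
      ... | v , v∈ , refl = let v∈S , le = ∈-filter⁻ light? {xs = S} v∈ in le , v , v∈S , refl
      open Plan (plan (length R) R ≤-refl bad)

      -- A boosted vertex would have put this light cluster into `R`, so radius `W j` suffices.
      plain-ok : ∀ {j} → π j ≡ j → ¬ (∃[ i ] (i ≢ j × π i ≡ j)) → j ∉ R → W j ≤ 3 →
        OK (λ v → π (ℓ v) ≡ j) (W j)
      plain-ok {j} πj≡j unmerged j∉R W≤3 =
        ball (hub j) (W j) , cheap (≤-reflexive (sum-δ (hub j) (W j))) , cover
        where
        cover : ∀ {v y} → π (ℓ v) ≡ j → 0 < f v → D y v (r v) → (v ∉ S → ¬ Ω y) →
          Dominated G (ball (hub j) (W j)) y
        cover {v} {y} v∈ 0<v d _ with only unmerged v∈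
        ... | refl = dominated-ball (≤-trans 0<v (mass-≥₁ {π ∘ ℓ} πj≡j))
          (inner πj≡j 0<v (subst (D y v) (boost-∉ S v∉S) d))
          where
          v∉S : v ∉ S
          v∉S v∈S = j∉R (∈-map⁺ ℓ (∈-filter⁺ light? v∈S (≤-trans (mass≤W πj≡j) W≤3)))

      heavy-ok : ∀ {j} → 4 ≤ W j → OK (λ v → π (ℓ v) ≡ j) (W j)
      heavy-ok {j} 4≤W = ball (hub j) (suc (W j))
        , ≤-trans (≤-reflexive (trans (cong (4 *_) (sum-δ (hub j) _)) (*-suc 4 (W j))))
            (+-monoˡ-≤ (4 * W j) 4≤W)
        , λ {v} {y} v∈ 0<v d _ → dominated-ball (s≤s z≤n)
            (subst (λ a → D y (hub a) (suc (W a))) v∈ (outer 0<v d))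

      all-ok : ∀ j → OK (λ v → π (ℓ v) ≡ j) (W j)
      all-ok j with π j ≟ j
      -- By idempotence of `π` no vertex belongs to this class, so the zero function covers it.
      ... | no πj≢j = (λ _ → 0) , ≤-trans (≤-reflexive (cong (4 *_) (sum-replicate-zero n))) z≤n
        , λ v∈ _ _ _ → contradiction (subst (λ a → π a ≡ a) v∈ (idem _)) πj≢j
      ... | yes πj≡j with merged? j
      ...   | yes mj = merged-ok mj
      ...   | no unmerged with _∈?_ _≟_ j R
      ...     | yes j∈R = subst (λ a → OK (λ v → π (ℓ v) ≡ a) (W a)) πj≡j (ok j∈R)
      ...     | no j∉R with 4 ≤? W j
      ...       | yes 4≤W = heavy-ok 4≤W
      ...       | no W≱4  = plain-ok πj≡j unmerged j∉R (≤-pred (≰⇒> W≱4))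

      part : Fin n → Fin n → ℕ
      part j = proj₁ (all-ok j)

      total : Fin n → ℕ
      total v = sum λ j → part j v

      cost : 4 * sum total ≤ 5 * sum f
      cost = begin
        4 * sum total                 ≡⟨ cong (4 *_) (∑-comm (λ v j → part j v)) ⟩
        4 * sum (λ j → sum (part j))  ≡⟨ sum-*ˡ 4 (λ j → sum (part j)) ⟩
        sum (λ j → 4 * sum (part j))  ≤⟨ sum-mono (λ j → proj₁ (proj₂ (all-ok j))) ⟩
        sum (λ j → 5 * W j)           ≡⟨ sum-*ˡ 5 W ⟨
        5 * sum W                     ≡⟨ cong (5 *_) (sum-mass (π ∘ ℓ)) ⟩
        5 * sum f                     ∎
        where open ≤-Reasoning

      covered : ∀ {v y} → 0 < f v → D y v (r v) → (v ∉ S → ¬ Ω y) → Dominated G total y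
      covered {v} 0<v d ¬Ω = dominated-mono (λ u → sum-≥₁ (λ j → part j u) (π (ℓ v)))
        (proj₂ (proj₂ (all-ok (π (ℓ v)))) refl 0<v d ¬Ω)

      boosted-covered : ∀ {y} → Ω y → Dominated G total y
      boosted-covered {y} (v , v∈S , d) = covered (positive v v∈S)
        (subst (D y v) (≡-sym (boost-∈ S v∈S)) d) (λ v∉S → contradiction v∈S v∉S)

      -- Vertices of `Ω` are covered through a boosted ball, so the exemption in `OK` does no harm;
      -- outside `Ω` the exemption is void, and an undominated vertex cannot occur there.
      dominated : ∀ u → Dominated G total u
      dominated u with any? (λ v → _∈?_ _≟_ v S ×-dec D? u v (suc (f v))) | dominated? f u
      ... | yes ω | _                  = boosted-covered ω
      ... | no ¬ω | yes (v , 0<v , d)  = covered 0<v (D-mono (boost-≥ S v) d) (λ _ → ¬ω)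
      ... | no ¬ω | no ¬dom            = contradiction (covering u ¬dom) ¬ω

theorem1 : (n : ℕ) (G : Graph n) → NoIsolated G →
    (γ i : ℕ) → IsBroadcastNumber G γ → IsIrNumber G i →
    4 * γ ≤ 5 * i
theorem1 n G noIsolated γ i (_ , γ-least) ((f , maximal , refl) , _) = begin
  4 * γ        ≤⟨ *-monoʳ-≤ 4 (γ-least h broadcast dominating) ⟩
  4 * σ G h    ≤⟨ *-monoʳ-≤ 4 σh≤ ⟩
  4 * sum g    ≤⟨ cost ⟩
  5 * sum f    ≡⟨ cong (5 *_) (σ≡sum f) ⟨
  5 * σ G f    ∎
  where
  open ≤-Reasoning
  open Distance G
  within : ∃[ g ] (4 * sum g ≤ 5 * sum f × (∀ u → Dominated G g u))
  within = dominating-within G noIsolated f maximal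
    (boostSet G noIsolated f maximal) (clustering G noIsolated f maximal _)
  g : Fin n → ℕ
  g = proj₁ within
  cost : 4 * sum g ≤ 5 * sum f
  cost = proj₁ (proj₂ within)
  -- The radii of `g` may exceed eccentricities; truncation restores a broadcast at no cost.
  truncated : ∃[ h ] (IsBroadcast G h × IsDominating G h × σ G h ≤ sum g)
  truncated = truncate noIsolated g (proj₂ (proj₂ within))
  h : Fin n → ℕ
  h = proj₁ truncated
  broadcast : IsBroadcast G h
  broadcast = proj₁ (proj₂ truncated)
  dominating : IsDominating G h
  dominating = proj₁ (proj₂ (proj₂ truncated))
  σh≤ : σ G h ≤ sum g
  σh≤ = proj₂ (proj₂ (proj₂ truncated))
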